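{- There exists a seeded aTAM system at temperature $2$ which strictly self-assembles the discrete self-similar fractal shape $K^\infty$, where $K=\{0,\ldots,5\}^2\setminus\{2,3\}^2$.
   Context: aTAM: a tile type over a glue alphabet $\Sigma$ is an element of $\Sigma^{\{N,E,S,W\}}$ (a glue on each side). A seeded tile assembly system $\mathcal S$ consists of a finite set of tile types, a strength function $\mathrm{str}:\Sigma\to\mathbb Z$, a temperature $\tau\in\mathbb N$ and a seed assembly. An assembly is a partial map $A:\mathbb Z^2\rightharpoonup$ tile types. For adjacent positions $z,z+d$ in $\mathrm{dom}(A)$ the binding strength of the edge is $\mathrm{str}(g)$ if $A(z)(d)=A(z+d)(-d)=g$ and $0$ otherwise. $A$ is stable if every cut of its binding graph has total strength $\ge\tau$. An attachment places a tile at a position not in $\mathrm{dom}(A)$ such that the result is stable. Productions are assemblies obtained from the seed by a finite or infinite sequence of attachments (infinite sequences yield the union); a production is terminal if no attachment is possible. $\mathcal S$ strictly self-assembles $X\subseteq\mathbb Z^2$ if every terminal production has domain exactly $X$. Discrete self-similar fractals: for a finite $G\subseteq\mathbb N^2$ with $(0,0)\in G$, let $w,h$ be the width and height of its bounding box (i.e. $1+\max$ of the $x$-, resp. $y$-coordinates), and $\sigma_G(X)=\{p\in\mathbb N^2:(\lfloor p_x/w\rfloor,\lfloor p_y/h\rfloor)\in X,\ (p_x\bmod w,p_y\bmod h)\in G\}$ (each point replaced by a copy of $G$). $G^i=\sigma_G^i(\{(0,0)\})$ and $G^\infty=\bigcup_{i}G^i$. -}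

module Defs where

open import Data.Nat as ℕ using (ℕ; zero; suc; _⊔_; _<_)
open import Data.Nat.DivMod using (_/_; _%_)
open import Data.Integer as ℤ using (ℤ; +_; -[1+_]; _+_)
open import Data.Integer.Properties as ℤP using ()
open import Data.Product using (Σ; ∃; _×_; _,_; proj₁; proj₂)
open import Data.Product.Properties using (≡-dec)
open import Data.Maybe using (Maybe; just; nothing)
open import Data.List using (List; []; _∷_; foldr; map; filter; cartesianProduct; upTo)
open import Data.List.Membership.Propositional using (_∈_)
open import Data.List.Relation.Unary.All using (All)
open import Data.List.Relation.Unary.Unique.Propositional using (Unique)
open import Data.List.Relation.Binary.Subset.Propositional using (_⊆_)
open import Relation.Nullary using (¬_; yes; no; Dec)
open import Relation.Nullary.Decidable using (_×-dec_; ¬?)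
open import Relation.Binary.PropositionalEquality using (_≡_; _≢_)
open import Data.Bool using (Bool; true; false)
open import Data.Sum using (_⊎_)
open import Function.Bundles using (_⇔_)

Pos : Set
Pos = ℤ × ℤ

data Dir : Set where
  N E S W : Dir

opp : Dir → Dir
opp N = S
opp E = W
opp S = N
opp W = E

offset : Dir → Pos
offset N = (+ 0 , + 1)
offset E = (+ 1 , + 0)
offset S = (+ 0 , -[1+ 0 ])
offset W = (-[1+ 0 ] , + 0)

_⊕_ : Pos → Dir → Pos
(x , y) ⊕ d = (x + proj₁ (offset d) , y + proj₂ (offset d))

_≟ₚ_ : (p q : Pos) → Dec (p ≡ q)
_≟ₚ_ = ≡-dec ℤ._≟_ ℤ._≟_

-- Tiles over the glue alphabet ℕ (any finite alphabet embeds into ℕ)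

record Tile : Set where
  constructor tile
  field
    gN gE gS gW : ℕ

glue : Tile → Dir → ℕ
glue t N = Tile.gN t
glue t E = Tile.gE t
glue t S = Tile.gS t
glue t W = Tile.gW t

Assembly : Set
Assembly = Pos → Maybe Tile

InDom : Assembly → Pos → Set
InDom A p = Σ Tile λ t → A p ≡ just t

edgeStr : (ℕ → ℤ) → Tile → Dir → Tile → ℤ
edgeStr str t d t' with glue t d ℕ.≟ glue t' (opp d)
... | yes _ = str (glue t d)
... | no _ = + 0

Edge : Set
Edge = Pos × Dir

edgeWeight : (ℕ → ℤ) → Assembly → Edge → ℤ
edgeWeight str A (z , d) with A z | A (z ⊕ d)
... | just t | just t' = edgeStr str t d t'
... | _ | _ = + 0

sumW : (ℕ → ℤ) → Assembly → List Edge → ℤ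
sumW str A = foldr (λ e s → edgeWeight str A e + s) (+ 0)

Crossing : Assembly → (Pos → Bool) → Edge → Set
Crossing A C (z , d) = C z ≡ true × InDom A (z ⊕ d) × C (z ⊕ d) ≡ false

-- "the total strength of the (possibly infinite) set of edges crossing
-- the cut is ≥ τ": there is a finite set F of crossing edges such that
-- every finite duplicate-free set of crossing edges containing F has
-- total strength ≥ τ.  (For finitely many crossing edges this is exactly
-- "sum of all crossing edges ≥ τ".)
CutStrongEnough : (ℕ → ℤ) → ℕ → Assembly → (Pos → Bool) → Set
CutStrongEnough str τ A C =
  Σ (List Edge) λ F → All (Crossing A C) F ×
    ((F' : List Edge) → All (Crossing A C) F' → Unique F' → F ⊆ F' →
       (+ τ) ℤ.≤ sumW str A F')

Stable : (ℕ → ℤ) → ℕ → Assembly → Set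
Stable str τ A =
  (C : Pos → Bool) → (∀ p → C p ≡ true → InDom A p) →
  Σ Pos (λ p → C p ≡ true) → Σ Pos (λ p → InDom A p × C p ≡ false) →
  CutStrongEnough str τ A C

record TAS : Set where
  field
    tiles : List Tile
    str   : ℕ → ℤ
    temp  : ℕ
    seed  : List (Pos × Tile)

lookupSeed : List (Pos × Tile) → Assembly
lookupSeed [] p = nothing
lookupSeed ((q , t) ∷ xs) p with p ≟ₚ q
... | yes _ = just t
... | no _ = lookupSeed xs p

module _ (𝒮 : TAS) where
  open TAS 𝒮

  seedAsm : Assembly
  seedAsm = lookupSeed seed

  Attach : Assembly → Assembly → Set
  Attach A B = Σ Pos λ z → Σ Tile λ t →
    t ∈ tiles × A z ≡ nothing × B z ≡ just t ×
    (∀ p → p ≢ z → B p ≡ A p) × Stable str temp B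

  -- A is the union of a (finite or infinite) sequence of attachments
  -- starting at the seed; finite sequences are encoded by allowing
  -- idle steps.
  Production : Assembly → Set
  Production A = Σ (ℕ → Assembly) λ α →
    (∀ p → α 0 p ≡ seedAsm p) ×
    (∀ n → Attach (α n) (α (suc n)) ⊎ (∀ p → α (suc n) p ≡ α n p)) ×
    (∀ p t → (A p ≡ just t) ⇔ (Σ ℕ λ n → α n p ≡ just t))

  Terminal : Assembly → Set
  Terminal A = ¬ (Σ Assembly λ B → Attach A B)

  StrictlySelfAssembles : (Pos → Set) → Set
  StrictlySelfAssembles X =
    (A : Assembly) → Production A → Terminal A → ∀ p → InDom A p ⇔ X p

Pt : Set
Pt = ℕ × ℕ

width height : List Pt → ℕ
width G = suc (foldr (λ p m → proj₁ p ⊔ m) 0 G)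
height G = suc (foldr (λ p m → proj₂ p ⊔ m) 0 G)

σ : List Pt → (Pt → Set) → Pt → Set
σ G X (x , y) = X (x / width G , y / height G) × ((x % width G , y % height G) ∈ G)

power : List Pt → ℕ → Pt → Set
power G zero p = p ≡ (0 , 0)
power G (suc i) = σ G (power G i)

infPower : List Pt → Pt → Set
infPower G p = Σ ℕ λ i → power G i p

FractalShape : List Pt → Pos → Set
FractalShape G p = Σ Pt λ q → p ≡ (+ proj₁ q , + proj₂ q) × infPower G q

inCenter? : (p : Pt) → Dec ((2 ℕ.≤ proj₁ p × proj₁ p ℕ.≤ 3) × (2 ℕ.≤ proj₂ p × proj₂ p ℕ.≤ 3))
inCenter? (x , y) = ((2 ℕ.≤? x) ×-dec (x ℕ.≤? 3)) ×-dec ((2 ℕ.≤? y) ×-dec (y ℕ.≤? 3))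

K : List Pt
K = filter (λ p → ¬? (inCenter? p)) (cartesianProduct (upTo 6) (upTo 6))

-- A block of level n + 1 of the fractal consists of 32 blocks of level n around a hole.  The
-- borders between these form lines, and every line knows between which two blocks of their common
-- parent it runs.  This label is all a block has to know about its side: labels of vertical lines
-- travel north, those of horizontal lines travel east, and two crossing lines determine each
-- other's continuation.  Three devices make this work.
-- * A block without a western neighbour (east of a hole, or on the border of the quadrant) learns
--   only vertical lines.  The horizontal line on its north side is created at its north-east
--   corner, where it meets a vertical line of the same level, and its label runs back west along
--   the top row.  Blocks without a southern neighbour are treated symmetrically.
-- * At a crossing one has to know which of the two lines belongs to the larger block.  This is
--   read off a mark which travels along the diagonal of each block, around its hole, and tells
--   whether the block lies in the last column or in the last row of its parent.
-- * Blocks of all levels carry the same finite data, so that the tile at (x , y) is computed by a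
--   finite automaton reading the base 6 digits of x and y.
-- That neighbouring tiles match, that each tile is determined by its inputs, and that these have
-- total strength 2 are then finitely many statements about 951 states, verified by evaluation.
-- As no tile depends on itself (tiles are ordered lexicographically along the hierarchy of
-- blocks), all productions stay inside this one assembly, and the terminal ones fill it.
module Submission where

open import Defs
open import Data.Bool as Bool using (Bool; true; false; if_then_else_; _∧_; _∨_; not)
open import Data.Bool.ListAction using (all)
open import Data.Bool.Properties using () renaming (_≟_ to _≟ᵇ_)
open import Data.Empty using (⊥; ⊥-elim)
open import Data.Integer as ℤ using (ℤ; +_; -[1+_]; ∣_∣)
import Data.Integer.Properties as ℤ
open import Data.List using (List; []; _∷_; _++_; foldr; map; upTo; cartesianProduct)
open import Data.List.Membership.Propositional using (_∈_)
open import Data.List.Membership.Propositional.Properties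
open import Data.List.Properties using (∷-injective)
open import Data.List.Relation.Binary.Subset.Propositional using (_⊆_)
open import Data.List.Relation.Unary.All as All using (All; []; _∷_)
open import Data.List.Relation.Unary.AllPairs using ([]; _∷_)
open import Data.List.Relation.Unary.Any using (here; there)
open import Data.List.Relation.Unary.Unique.Propositional using (Unique)
open import Data.Maybe as Maybe using (Maybe; just; nothing; maybe; is-nothing)
open import Data.Maybe.Properties using (just-injective)
open import Data.Nat using (ℕ; zero; suc; _+_; _*_; _∸_; _≤_; _<_; _/_; _%_; _≡ᵇ_; _<ᵇ_; z≤n; s≤s)
open import Data.Nat.DivMod
open import Data.Nat.Induction using (<-wellFounded)
open import Data.Nat.ListAction using (sum)
import Data.Nat.Properties as ℕ
open import Data.Product using (Σ; ∃; _×_; _,_; proj₁; proj₂)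
open import Data.Sum using (_⊎_; inj₁; inj₂)
open import Function using (_∘_; case_of_)
open import Function.Bundles using (_⇔_; mk⇔; Equivalence)
open import Induction.WellFounded using (Acc; acc)
open import Relation.Binary.PropositionalEquality
open import Relation.Nullary using (¬_; yes; no; does)
open import Relation.Nullary.Decidable using (¬?)

open import Algebra.Properties.AbelianGroup ℤ.+-0-abelianGroup using () renaming (∙-cancelˡ to ℤ-cancel)

-- Assemblies in which every tile is determined by its inputs

⊕-opp : ∀ p d → (p ⊕ d) ⊕ opp d ≡ p
⊕-opp (x , y) N = cong₂ _,_ (trans (ℤ.+-identityʳ _) (ℤ.+-identityʳ x)) (trans (ℤ.+-assoc y (+ 1) _) (ℤ.+-identityʳ y))
⊕-opp (x , y) E = cong₂ _,_ (trans (ℤ.+-assoc x (+ 1) _) (ℤ.+-identityʳ x)) (trans (ℤ.+-identityʳ _) (ℤ.+-identityʳ y))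
⊕-opp (x , y) S = cong₂ _,_ (trans (ℤ.+-identityʳ _) (ℤ.+-identityʳ x)) (trans (ℤ.+-assoc y -[1+ 0 ] _) (ℤ.+-identityʳ y))
⊕-opp (x , y) W = cong₂ _,_ (trans (ℤ.+-assoc x -[1+ 0 ] _) (ℤ.+-identityʳ x)) (trans (ℤ.+-identityʳ _) (ℤ.+-identityʳ y))

opp-opp : ∀ d → opp (opp d) ≡ d
opp-opp N = refl
opp-opp E = refl
opp-opp S = refl
opp-opp W = refl

i≢i+1 : ∀ i → i ≢ i ℤ.+ + 1
i≢i+1 i eq = case ℤ-cancel i (+ 0) (+ 1) (trans (ℤ.+-identityʳ i) eq) of λ ()

i≢i-1 : ∀ i → i ≢ i ℤ.+ -[1+ 0 ]
i≢i-1 i eq = case ℤ-cancel i (+ 0) -[1+ 0 ] (trans (ℤ.+-identityʳ i) eq) of λ ()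

⊕-≢ : ∀ p d → p ⊕ d ≢ p
⊕-≢ (x , y) N eq = i≢i+1 y (sym (cong proj₂ eq))
⊕-≢ (x , y) E eq = i≢i+1 x (sym (cong proj₁ eq))
⊕-≢ (x , y) S eq = i≢i-1 y (sym (cong proj₂ eq))
⊕-≢ (x , y) W eq = i≢i-1 x (sym (cong proj₁ eq))

dirs : List Dir
dirs = N ∷ E ∷ S ∷ W ∷ []

∈-dirs : ∀ d → d ∈ dirs
∈-dirs N = here refl
∈-dirs E = there (here refl)
∈-dirs S = there (there (here refl))
∈-dirs W = there (there (there (here refl)))

-- Sums of natural numbers over lists

module _ {A : Set} where

  sum-mono : ∀ {f g : A → ℕ} → (∀ x → f x ≤ g x) → ∀ xs → sum (map f xs) ≤ sum (map g xs)
  sum-mono le []       = z≤n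
  sum-mono le (x ∷ xs) = ℕ.+-mono-≤ (le x) (sum-mono le xs)

  -- The reverse inequality of the totals leaves no slack in any term. This is what turns "strength
  -- at least 2" into "every input is used".
  sum-tight : ∀ {f g : A → ℕ} → (∀ x → f x ≤ g x) → ∀ xs →
              sum (map g xs) ≤ sum (map f xs) → ∀ {x} → x ∈ xs → f x ≡ g x
  sum-tight {f} {g} le (y ∷ xs) ge (here refl) =
    ℕ.≤-antisym (le y) (ℕ.+-cancelʳ-≤ (sum (map f xs)) (g y) (f y)
      (ℕ.≤-trans (ℕ.+-monoʳ-≤ (g y) (sum-mono le xs)) ge))
  sum-tight {f} {g} le (y ∷ xs) ge (there x∈) =
    sum-tight le xs (ℕ.+-cancelˡ-≤ (f y) _ _ (ℕ.≤-trans (ℕ.+-monoˡ-≤ _ (le y)) ge)) x∈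

  sum-⊆ : ∀ (f : A → ℕ) {xs ys} → Unique xs → xs ⊆ ys → sum (map f xs) ≤ sum (map f ys)
  sum-⊆ f {[]}     _        _   = z≤n
  sum-⊆ f {x ∷ xs} (x∉ ∷ u) sub with ∈-∃++ (sub (here refl))
  ... | ys , zs , refl = begin
    f x + sum (map f xs)                  ≤⟨ ℕ.+-monoʳ-≤ (f x) (sum-⊆ f u sub′) ⟩
    f x + sum (map f (ys ++ zs))          ≡⟨ cong (λ l → f x + l) (split ys zs) ⟩
    f x + (sum (map f ys) + sum (map f zs)) ≡⟨ swap (f x) (sum (map f ys)) _ ⟩
    sum (map f ys) + sum (map f (x ∷ zs)) ≡⟨ sym (split ys (x ∷ zs)) ⟩
    sum (map f (ys ++ x ∷ zs))            ∎
    where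
    open ℕ.≤-Reasoning
    split : ∀ as bs → sum (map f (as ++ bs)) ≡ sum (map f as) + sum (map f bs)
    split []       bs = refl
    split (a ∷ as) bs = trans (cong (λ l → f a + l) (split as bs)) (sym (ℕ.+-assoc (f a) _ _))
    swap : ∀ a b c → a + (b + c) ≡ b + (a + c)
    swap a b c = trans (sym (ℕ.+-assoc a b c)) (trans (cong (λ l → l + c) (ℕ.+-comm a b)) (ℕ.+-assoc b a c))
    sub′ : xs ⊆ ys ++ zs
    sub′ v∈ with ∈-++⁻ ys (sub (there v∈))
    ... | inj₁ l         = ∈-++⁺ˡ l
    ... | inj₂ (here eq) = ⊥-elim (All.lookup x∉ v∈ (sym eq))
    ... | inj₂ (there r) = ∈-++⁺ʳ ys r

-- Glues as numbers: strength and direction of information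

strength : ℕ → ℕ
strength g = g % 4

is : ℕ → Bool
is 0 = false
is _ = true

-- Bit 2 of a glue tells in which direction information crosses the edge:
-- backward means southward or westward.
backward : ℕ → Bool
backward g = 3 <ᵇ g % 8

inward : Dir → ℕ → Bool
inward N g = backward g ∧ is (strength g)
inward E g = backward g ∧ is (strength g)
inward S g = not (backward g) ∧ is (strength g)
inward W g = not (backward g) ∧ is (strength g)

∧-trueʳ : ∀ {a b} → a ∧ b ≡ true → b ≡ true
∧-trueʳ {true} eq = eq

inward⇒strength : ∀ d g → inward d g ≡ true → strength g ≢ 0
inward⇒strength d g in! eq = case trans (sym (positive d in!)) (cong is eq) of λ ()
  where
  positive : ∀ d → inward d g ≡ true → is (strength g) ≡ true
  positive N = ∧-trueʳ {backward g}
  positive E = ∧-trueʳ {backward g}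
  positive S = ∧-trueʳ {not (backward g)}
  positive W = ∧-trueʳ {not (backward g)}

outward⇒inward : ∀ d g → strength g ≢ 0 → inward d g ≡ false → inward (opp d) g ≡ true
outward⇒inward d g pos out = go d (≢0⇒is (strength g) pos) out
  where
  ≢0⇒is : ∀ n → n ≢ 0 → is n ≡ true
  ≢0⇒is zero    n≢0 = ⊥-elim (n≢0 refl)
  ≢0⇒is (suc _) _   = refl
  flip : ∀ {a b} → b ≡ true → a ∧ b ≡ false → not a ∧ b ≡ true
  flip {false} b! _   = b!
  flip {true}  b! eq = trans (sym eq) b!
  unflip : ∀ {a b} → b ≡ true → not a ∧ b ≡ false → a ∧ b ≡ true
  unflip {true}  b! _  = b!
  unflip {false} b! eq = trans (sym eq) b!
  go : ∀ d → is (strength g) ≡ true → inward d g ≡ false → inward (opp d) g ≡ true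
  go N = flip {backward g}
  go E = flip {backward g}
  go S = unflip {backward g}
  go W = unflip {backward g}

inputGlue : Tile → Dir → ℕ
inputGlue t d = if inward d (glue t d) then glue t d else 0

inputStrength : Tile → ℕ
inputStrength t = sum (map (strength ∘ inputGlue t) dirs)

glueAt : Maybe Tile → Dir → ℕ
glueAt nothing  d = 0
glueAt (just t) d = glue t d

-- `canon` is the intended final assembly. The inputs of each tile except the seed have total
-- strength exactly 2 and determine the tile, and `rank` makes the dependence on inputs
-- well-founded. So a tile can attach only where and as `canon` prescribes, and some tile can attach
-- until `canon` is filled.
module Deterministic
  (canon : Pos → Maybe Tile) (tiles : List Tile) (origin : Pos) (seedTile : Tile)
  (start : canon origin ≡ just seedTile)
  (member : ∀ {p t} → canon p ≡ just t → t ∈ tiles)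
  (inputs : ∀ {t} → t ∈ tiles → inputStrength t ≡ 2 ⊎ t ≡ seedTile)
  (seed-inputs : inputStrength seedTile ≡ 0)
  (seed-once : ∀ {p} → canon p ≡ just seedTile → p ≡ origin)
  (determined : ∀ {t t′} → t ∈ tiles → t′ ∈ tiles →
                (∀ d → inputGlue t d ≡ inputGlue t′ d) → t ≡ t′)
  (adjacent : ∀ p d → glueAt (canon p) d ≡ glueAt (canon (p ⊕ d)) (opp d))
  (rank : Pos → ℕ)
  (descends : ∀ {p t} d → canon p ≡ just t → inward d (glue t d) ≡ true → rank (p ⊕ d) < rank p)
  where

  system : TAS
  system = record { tiles = tiles ; str = λ g → + strength g ; temp = 2 ; seed = (origin , seedTile) ∷ [] }

  str : ℕ → ℤ
  str = TAS.str system

  -- The invariant of all productions. `closed` excludes growth against the direction of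
  -- information: a placed tile never waits for an input from an empty neighbour.
  record Consistent (A : Assembly) : Set where
    field
      sound  : ∀ {p t} → A p ≡ just t → canon p ≡ just t
      closed : ∀ {p t} d → A p ≡ just t → inward d (glue t d) ≡ true → InDom A (p ⊕ d)
      seeded : InDom A origin
  open Consistent

  inputGlue-inward : ∀ t d → inward d (glue t d) ≡ true → inputGlue t d ≡ glue t d
  inputGlue-inward t d in! rewrite in! = refl

  seed-outward : ∀ d → inward d (glue seedTile d) ≡ true → ⊥
  seed-outward d in! = inward⇒strength d _ in! (trans (cong strength (sym (inputGlue-inward seedTile d in!)))
    (ℕ.n≤0⇒n≡0 (subst (strength (inputGlue seedTile d) ≤_) seed-inputs (bound dirs (∈-dirs d)))))
    where
    bound : ∀ ds → d ∈ ds → strength (inputGlue seedTile d) ≤ sum (map (strength ∘ inputGlue seedTile) ds)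
    bound (_ ∷ ds) (here refl) = ℕ.m≤m+n _ _
    bound (e ∷ ds) (there d∈)  = ℕ.≤-trans (bound ds d∈) (ℕ.m≤n+m _ (strength (inputGlue seedTile e)))

  canon-inputs : ∀ {p t} → canon p ≡ just t → p ≢ origin → inputStrength t ≡ 2
  canon-inputs c p≢ with inputs (member c)
  ... | inj₁ two  = two
  ... | inj₂ refl = ⊥-elim (p≢ (seed-once c))

  weight : Assembly → Edge → ℕ
  weight A e = ∣ edgeWeight str A e ∣

  edgeStr-+ : ∀ t d t′ → edgeStr str t d t′ ≡ + ∣ edgeStr str t d t′ ∣
  edgeStr-+ t d t′ with glue t d ℕ.≟ glue t′ (opp d)
  ... | yes _ = refl
  ... | no _  = refl

  edgeWeight-+ : ∀ A e → edgeWeight str A e ≡ + weight A e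
  edgeWeight-+ A (z , d) with A z | A (z ⊕ d)
  ... | just t  | just t′ = edgeStr-+ t d t′
  ... | just _  | nothing = refl
  ... | nothing | just _  = refl
  ... | nothing | nothing = refl

  sumW-+ : ∀ A es → sumW str A es ≡ + sum (map (weight A) es)
  sumW-+ A []       = refl
  sumW-+ A (e ∷ es) = trans (cong₂ ℤ._+_ (edgeWeight-+ A e) (sumW-+ A es)) (sym (ℤ.pos-+ (weight A e) _))

  weight-just : ∀ {A z d t t′} → A z ≡ just t → A (z ⊕ d) ≡ just t′ →
                weight A (z , d) ≡ ∣ edgeStr str t d t′ ∣
  weight-just {A} {z} {d} eq eq′ with A z | A (z ⊕ d)
  weight-just refl refl | just _ | just _ = refl

  weight-nothing : ∀ {A z d} → A (z ⊕ d) ≡ nothing → weight A (z , d) ≡ 0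
  weight-nothing {A} {z} {d} eq with A z | A (z ⊕ d)
  weight-nothing refl | just _  | nothing = refl
  weight-nothing refl | nothing | nothing = refl

  edgeStr-match : ∀ {t d t′} → glue t d ≡ glue t′ (opp d) → ∣ edgeStr str t d t′ ∣ ≡ strength (glue t d)
  edgeStr-match {t} {d} {t′} eq with glue t d ℕ.≟ glue t′ (opp d)
  ... | yes _  = refl
  ... | no neq = ⊥-elim (neq eq)

  edgeStr-mismatch : ∀ {t d t′} → glue t d ≢ glue t′ (opp d) → ∣ edgeStr str t d t′ ∣ ≡ 0
  edgeStr-mismatch {t} {d} {t′} neq with glue t d ℕ.≟ glue t′ (opp d)
  ... | yes eq = ⊥-elim (neq eq)
  ... | no _   = refl

  adjacent-just : ∀ {p t t′} d → canon p ≡ just t → canon (p ⊕ d) ≡ just t′ → glue t d ≡ glue t′ (opp d)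
  adjacent-just {p} d eq eq′ = subst₂ (λ u v → glueAt u d ≡ glueAt v (opp d)) eq eq′ (adjacent p d)

  canon-⊕ : ∀ {p t} d → canon p ≡ just t → inward d (glue t d) ≡ true → InDom canon (p ⊕ d)
  canon-⊕ {p} {t} d c in! with canon (p ⊕ d) in eq
  ... | just t′ = t′ , refl
  ... | nothing = ⊥-elim (inward⇒strength d _ in! (cong strength zero-glue))
    where
    zero-glue : glue t d ≡ 0
    zero-glue = subst₂ (λ u v → glueAt u d ≡ glueAt v (opp d)) c eq (adjacent p d)

  -- A crossing edge is listed from its end inside the cut, so its orientation depends on the side
  -- `b` on which `r` lies.
  inputEdge : Bool → Pos → Dir → Edge
  inputEdge true  r d = r , d
  inputEdge false r d = r ⊕ d , opp d

  inputEdge-injective : ∀ b r {d d′} → inputEdge b r d ≡ inputEdge b r d′ → d ≡ d′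
  inputEdge-injective true  r eq = cong proj₂ eq
  inputEdge-injective false r {d} {d′} eq =
    trans (sym (opp-opp d)) (trans (cong (opp ∘ proj₂) eq) (opp-opp d′))

  inputEdges : Bool → Pos → Tile → List Dir → List Edge
  inputEdges b r t [] = []
  inputEdges b r t (d ∷ ds) = if inward d (glue t d) then inputEdge b r d ∷ inputEdges b r t ds
                              else inputEdges b r t ds

  inputEdges-All : ∀ {P : Edge → Set} b r t → (∀ d → inward d (glue t d) ≡ true → P (inputEdge b r d)) →
                   ∀ ds → All P (inputEdges b r t ds)
  inputEdges-All b r t h [] = []
  inputEdges-All b r t h (d ∷ ds) with inward d (glue t d) in eq
  ... | true  = h d eq ∷ inputEdges-All b r t h ds
  ... | false = inputEdges-All b r t h ds

  inputEdges-∉ : ∀ b r t {d} ds → All (d ≢_) ds → All (inputEdge b r d ≢_) (inputEdges b r t ds)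
  inputEdges-∉ b r t [] [] = []
  inputEdges-∉ b r t (e ∷ ds) (d≢ ∷ ds≢) with inward e (glue t e)
  ... | true  = (d≢ ∘ inputEdge-injective b r) ∷ inputEdges-∉ b r t ds ds≢
  ... | false = inputEdges-∉ b r t ds ds≢

  inputEdges-Unique : ∀ b r t ds → Unique ds → Unique (inputEdges b r t ds)
  inputEdges-Unique b r t [] [] = []
  inputEdges-Unique b r t (d ∷ ds) (d≢ ∷ u) with inward d (glue t d)
  ... | true  = inputEdges-∉ b r t ds d≢ ∷ inputEdges-Unique b r t ds u
  ... | false = inputEdges-Unique b r t ds u

  dirs-Unique : Unique dirs
  dirs-Unique = ((λ ()) ∷ (λ ()) ∷ (λ ()) ∷ []) ∷ ((λ ()) ∷ (λ ()) ∷ []) ∷ ((λ ()) ∷ []) ∷ [] ∷ []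

  -- Stability of consistent assemblies

  module _ {A : Assembly} (con : Consistent A) where

    weight-inputEdge : ∀ {r t} b d → A r ≡ just t → inward d (glue t d) ≡ true →
                       weight A (inputEdge b r d) ≡ strength (glue t d)
    weight-inputEdge {r} {t} true d eq in! with closed con d eq in!
    ... | t′ , eq′ = trans (weight-just {A} {r} {d} eq eq′)
                           (edgeStr-match {t} {d} {t′} (adjacent-just d (sound con eq) (sound con eq′)))
    weight-inputEdge {r} {t} false d eq in! with closed con d eq in!
    ... | t′ , eq′ =
      trans (weight-just {A} {r ⊕ d} {opp d} eq′ (trans (cong A (⊕-opp r d)) eq))
      (trans (edgeStr-match {t′} {opp d} {t} (trans (sym match) (sym (cong (glue t) (opp-opp d)))))
             (cong strength (sym match)))
      where
      match : glue t d ≡ glue t′ (opp d)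
      match = adjacent-just d (sound con eq) (sound con eq′)

    weight-inputEdges : ∀ {r t} b → A r ≡ just t → ∀ ds →
      sum (map (weight A) (inputEdges b r t ds)) ≡ sum (map (strength ∘ inputGlue t) ds)
    weight-inputEdges b eq [] = refl
    weight-inputEdges {r} {t} b eq (d ∷ ds) with inward d (glue t d) in in!
    ... | true  = cong₂ _+_ (weight-inputEdge b d eq in!) (weight-inputEdges b eq ds)
    ... | false = weight-inputEdges b eq ds

    -- Along any cut, walking down the inputs from a tile that is separated from the
    -- seed ends at a tile all of whose input edges cross the cut.
    Frontier : (Pos → Bool) → Pos → Set
    Frontier C r = ∃ λ t → A r ≡ just t × C r ≢ C origin ×
                   (∀ d → inward d (glue t d) ≡ true → C (r ⊕ d) ≡ C origin)

    frontier : ∀ C {r t} → A r ≡ just t → C r ≢ C origin → ∃ (Frontier C)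
    frontier C {r} eq sep = go eq sep (<-wellFounded (rank r))
      where
      go : ∀ {r t} → A r ≡ just t → C r ≢ C origin → Acc _<_ (rank r) → ∃ (Frontier C)
      go {r} {t} eq sep (acc rs) = try dirs (λ d d∉ → ⊥-elim (d∉ (∈-dirs d)))
        where
        -- The directions no longer in `ds` have been examined already; the second argument records
        -- the outcome for them.
        try : ∀ ds → (∀ d → ¬ d ∈ ds → inward d (glue t d) ≡ true → C (r ⊕ d) ≡ C origin) → ∃ (Frontier C)
        try [] ok = r , t , eq , sep , λ d → ok d λ ()
        try (e ∷ ds) ok with inward e (glue t e) in in! | C (r ⊕ e) ≟ᵇ C origin
        ... | true | no sep′ =
          go (proj₂ (closed con e eq in!)) sep′ (rs (descends e (sound con eq) in!))
        ... | true | yes same = try ds ok′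
          where
          ok′ : ∀ d → ¬ d ∈ ds → inward d (glue t d) ≡ true → C (r ⊕ d) ≡ C origin
          ok′ d d∉ in′ with C (r ⊕ d) ≟ᵇ C origin
          ... | yes s = s
          ... | no ns = ok d (λ { (here refl) → ns same ; (there d∈) → d∉ d∈ }) in′
        ... | false | _ = try ds ok′
          where
          ok′ : ∀ d → ¬ d ∈ ds → inward d (glue t d) ≡ true → C (r ⊕ d) ≡ C origin
          ok′ d d∉ in′ = ok d (λ { (here refl) → case trans (sym in!) in′ of λ () ; (there d∈) → d∉ d∈ }) in′

    -- The input edges of a frontier tile cross the cut with total weight 2, and further edges
    -- cannot lower the sum because no weight is negative.
    frontier-strong : ∀ C → ∃ (Frontier C) → CutStrongEnough str 2 A C
    frontier-strong C (r , t , eq , sep , all-in) =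
      F , inputEdges-All b r t (crossing b refl) dirs , λ F′ _ _ sub →
        subst (ℤ._≤_ (+ 2)) (sym (sumW-+ A F′)) (ℤ.+≤+ (subst (_≤ sum (map (weight A) F′)) total
          (sum-⊆ (weight A) (inputEdges-Unique b r t dirs dirs-Unique) sub)))
      where
      b = C r
      F = inputEdges b r t dirs
      total : sum (map (weight A) F) ≡ 2
      total = trans (weight-inputEdges b eq dirs)
                (canon-inputs (sound con eq) λ r≡o → sep (cong C r≡o))
      crossing : ∀ b → C r ≡ b → ∀ d → inward d (glue t d) ≡ true → Crossing A C (inputEdge b r d)
      crossing true Cr d in! = Cr , closed con d eq in! , trans (all-in d in!) (other (C origin) refl)
        where
        other : ∀ c → C origin ≡ c → c ≡ false
        other false _ = refl
        other true Co = ⊥-elim (sep (trans Cr (sym Co)))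
      crossing false Cr d in! =
        trans (all-in d in!) (other (C origin) refl) , (t , trans (cong A (⊕-opp r d)) eq) , trans (cong C (⊕-opp r d)) Cr
        where
        other : ∀ c → C origin ≡ c → c ≡ true
        other true _ = refl
        other false Co = ⊥-elim (sep (trans Cr (sym Co)))

    -- One of the two witnesses of a nontrivial cut is separated from the origin; the search for a
    -- frontier tile starts there.
    stable : Stable str 2 A
    stable C C⊆A (p , Cp) (q , (t , Aq) , Cq) with C origin ≟ᵇ true
    ... | yes Co = frontier-strong C (frontier C Aq λ eq → case trans (sym Cq) (trans eq Co) of λ ())
    ... | no ¬Co = frontier-strong C (frontier C (proj₂ (C⊆A p Cp)) λ eq → ¬Co (trans (sym eq) Cp))

  adjacent′ : ∀ {p q t} d → q ≡ p ⊕ d → canon q ≡ just t → glueAt (canon p) d ≡ glue t (opp d)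
  adjacent′ {p} d refl c = trans (adjacent p d) (cong (λ u → glueAt u (opp d)) c)

  -- Attaching one tile to a consistent assembly

  module Step {A B : Assembly} (con : Consistent A) (z : Pos) (t : Tile) (t∈ : t ∈ tiles)
              (Az : A z ≡ nothing) (Bz : B z ≡ just t) (Bp : ∀ p → p ≢ z → B p ≡ A p)
              (stab : Stable str 2 B) where

    ≟-refl : does (z ≟ₚ z) ≡ true
    ≟-refl with z ≟ₚ z
    ... | yes _ = refl
    ... | no ne = ⊥-elim (ne refl)

    cut : Pos → Bool
    cut p = does (p ≟ₚ z)

    cut-true : ∀ p → cut p ≡ true → p ≡ z
    cut-true p eq with p ≟ₚ z
    ... | yes p≡z = p≡z

    cut-false : ∀ {p} → p ≢ z → cut p ≡ false
    cut-false {p} p≢z with p ≟ₚ z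
    ... | yes p≡z = ⊥-elim (p≢z p≡z)
    ... | no _    = refl

    z≢origin : origin ≢ z
    z≢origin refl = case trans (sym Az) (proj₂ (seeded con)) of λ ()

    strong : CutStrongEnough str 2 B cut
    strong = stab cut (λ p eq → t , trans (cong B (cut-true p eq)) Bz) (z , ≟-refl)
      (origin , (proj₁ (seeded con) , trans (Bp origin z≢origin) (proj₂ (seeded con))) , cut-false z≢origin)

    keep : Maybe Tile → Edge → List Edge → List Edge
    keep (just _) e es = e ∷ es
    keep nothing  e es = es

    around : List Dir → List Edge
    around [] = []
    around (d ∷ ds) = keep (B (z ⊕ d)) (z , d) (around ds)

    around-crossing : ∀ ds → All (Crossing B cut) (around ds)
    around-crossing [] = []
    around-crossing (d ∷ ds) with B (z ⊕ d) in eq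
    ... | just t′ = (≟-refl , (t′ , eq) , cut-false (⊕-≢ z d)) ∷ around-crossing ds
    ... | nothing = around-crossing ds

    around-∈ : ∀ {d t′} ds → d ∈ ds → B (z ⊕ d) ≡ just t′ → (z , d) ∈ around ds
    around-∈ (d ∷ ds) (here refl) eq with B (z ⊕ d)
    ... | just _ = here refl
    around-∈ (e ∷ ds) (there d∈) eq with B (z ⊕ e)
    ... | just _  = there (around-∈ ds d∈ eq)
    ... | nothing = around-∈ ds d∈ eq

    around-∉ : ∀ {d} ds → All (d ≢_) ds → All ((z , d) ≢_) (around ds)
    around-∉ [] [] = []
    around-∉ (e ∷ ds) (d≢ ∷ ds≢) with B (z ⊕ e)
    ... | just _  = (d≢ ∘ cong proj₂) ∷ around-∉ ds ds≢
    ... | nothing = around-∉ ds ds≢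

    around-Unique : ∀ ds → Unique ds → Unique (around ds)
    around-Unique [] [] = []
    around-Unique (d ∷ ds) (d≢ ∷ u) with B (z ⊕ d)
    ... | just _  = around-∉ ds d≢ ∷ around-Unique ds u
    ... | nothing = around-Unique ds u

    bond : Dir → ℕ
    bond d = weight B (z , d)

    around-sum : ∀ ds → sum (map (weight B) (around ds)) ≡ sum (map bond ds)
    around-sum [] = refl
    around-sum (d ∷ ds) = trans (keep-sum (B (z ⊕ d)) refl) (cong (λ n → bond d + n) (around-sum ds))
      where
      keep-sum : ∀ m → B (z ⊕ d) ≡ m →
                 sum (map (weight B) (keep m (z , d) (around ds))) ≡ bond d + sum (map (weight B) (around ds))
      keep-sum (just _) _  = refl
      keep-sum nothing  eq = cong (λ n → n + sum (map (weight B) (around ds))) (sym (weight-nothing {B} {z} {d} eq))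

    -- Stability across the cut that isolates `z`: `around dirs` lists all crossing edges, so it
    -- contains the finite witness.
    bonds≥2 : 2 ≤ sum (map bond dirs)
    bonds≥2 with strong
    ... | F , F-crossing , h = subst (2 ≤_) (around-sum dirs)
      (ℤ.drop‿+≤+ (subst (ℤ._≤_ (+ 2)) (sumW-+ B (around dirs))
        (h (around dirs) (around-crossing dirs) (around-Unique dirs dirs-Unique)
           λ {e} e∈ → F⊆ (All.lookup F-crossing e∈))))
      where
      F⊆ : ∀ {e} → Crossing B cut e → e ∈ around dirs
      F⊆ {p , d} (Cp , (t′ , eq) , _) with cut-true p Cp
      ... | refl = around-∈ dirs (∈-dirs d) eq

    data Bond (d : Dir) : Set where
      none : bond d ≡ 0 → Bond d
      some : bond d ≡ strength (inputGlue t d) → inward d (glue t d) ≡ true → InDom A (z ⊕ d) →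
             glueAt (canon z) d ≡ glue t d → Bond d

    -- A positive bond has to be an input of `t`: otherwise it is an input of the neighbour, and
    -- closedness of `A` would already put a tile at `z`.
    bonded : ∀ d → Bond d
    bonded d = go (B (z ⊕ d)) refl
      where
      inside : ∀ {t′} → B (z ⊕ d) ≡ just t′ → A (z ⊕ d) ≡ just t′
      inside eq = trans (sym (Bp _ (⊕-≢ z d))) eq
      go : ∀ m → B (z ⊕ d) ≡ m → Bond d
      go nothing eq = none (weight-nothing {B} {z} {d} eq)
      go (just t′) eq with glue t d ℕ.≟ glue t′ (opp d)
      ... | no neq = none (trans (weight-just {B} {z} {d} Bz eq) (edgeStr-mismatch {t} {d} {t′} neq))
      ... | yes match with strength (glue t d) ℕ.≟ 0
      ...   | yes weak = none (trans (weight-just {B} {z} {d} Bz eq) (trans (edgeStr-match {t} {d} {t′} match) weak))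
      ...   | no pos with inward d (glue t d) in in!
      ...     | true  = some
        (trans (weight-just {B} {z} {d} Bz eq) (trans (edgeStr-match {t} {d} {t′} match)
          (cong strength (sym (inputGlue-inward t d in!)))))
        in! (t′ , inside eq) (trans (adjacent′ d refl (sound con (inside eq))) (sym match))
      ...     | false = case trans (sym Az) (proj₂ z∈A) of λ ()
        where
        z∈A : InDom A z
        z∈A = subst (InDom A) (⊕-opp z d) (closed con (opp d) (inside eq)
          (subst (λ g → inward (opp d) g ≡ true) match (outward⇒inward d _ pos in!)))

    bond≤ : ∀ d → bond d ≤ strength (inputGlue t d)
    bond≤ d with bonded d
    ... | none eq       = subst (_≤ strength (inputGlue t d)) (sym eq) z≤n
    ... | some eq _ _ _ = ℕ.≤-reflexive eq

    t-inputs : inputStrength t ≡ 2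
    t-inputs with inputs t∈
    ... | inj₁ two  = two
    ... | inj₂ refl = case ℕ.≤-trans bonds≥2 (subst (sum (map bond dirs) ≤_) seed-inputs (sum-mono bond≤ dirs)) of λ ()

    -- The bonds total at least 2, the inputs exactly 2, and no bond exceeds its input.
    bond≡ : ∀ d → bond d ≡ strength (inputGlue t d)
    bond≡ d = sum-tight bond≤ dirs (subst (_≤ sum (map bond dirs)) (sym t-inputs) bonds≥2) (∈-dirs d)

    input : ∀ d → inward d (glue t d) ≡ true → InDom A (z ⊕ d) × glueAt (canon z) d ≡ glue t d
    input d in! with bonded d
    ... | some _ _ dom match = dom , match
    ... | none eq = ⊥-elim (inward⇒strength d _ in!
      (trans (cong strength (sym (inputGlue-inward t d in!))) (trans (sym (bond≡ d)) eq)))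

    canon-z : ∃ λ t′ → canon z ≡ just t′
    canon-z with canon z in eq
    ... | just t′ = t′ , refl
    ... | nothing = case trans (sym t-inputs) (no-inputs dirs) of λ ()
      where
      no-inputs : ∀ ds → sum (map (strength ∘ inputGlue t) ds) ≡ 0
      no-inputs [] = refl
      no-inputs (d ∷ ds) with inward d (glue t d) in in!
      ... | false = no-inputs ds
      ... | true  = ⊥-elim (inward⇒strength d _ in!
        (cong strength (trans (sym (proj₂ (input d in!))) (cong (λ u → glueAt u d) eq))))

    agrees : ∀ {t′} → canon z ≡ just t′ → ∀ d → inward d (glue t d) ≡ true → glue t′ d ≡ glue t d
    agrees c d in! = trans (sym (cong (λ u → glueAt u d) c)) (proj₂ (input d in!))

    inputs≤ : ∀ {t′} → canon z ≡ just t′ → ∀ d → strength (inputGlue t d) ≤ strength (inputGlue t′ d)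
    inputs≤ {t′} c d with inward d (glue t d) in in!
    ... | false = z≤n
    ... | true rewrite agrees c d in! | in! = ℕ.≤-refl

    -- All inputs of `t` occur on the tile of `canon` at `z`. That tile also has inputs of total
    -- strength 2, hence no others, and `determined` applies.
    unique : canon z ≡ just t
    unique with canon-z
    ... | t′ , c = trans c (cong just (sym (determined t∈ (member c) same)))
      where
      t′-inputs : inputStrength t′ ≡ 2
      t′-inputs = canon-inputs c (λ { refl → z≢origin refl })
      same : ∀ d → inputGlue t d ≡ inputGlue t′ d
      same d with inward d (glue t d) in in!
                | sum-tight (inputs≤ c) dirs (ℕ.≤-reflexive (trans t′-inputs (sym t-inputs))) (∈-dirs d)
      ... | true  | _ rewrite agrees c d in! | in! = refl
      ... | false | eq with inward d (glue t′ d) in in′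
      ...   | false = refl
      ...   | true  = ⊥-elim (inward⇒strength d _ in′ (sym eq))

    consistent : Consistent B
    consistent = record { sound = snd ; closed = cls
                        ; seeded = proj₁ (seeded con) , trans (Bp origin z≢origin) (proj₂ (seeded con)) }
      where
      mono : ∀ {p} → InDom A p → InDom B p
      mono {p} (u , eq) with p ≟ₚ z
      ... | yes refl = t , Bz
      ... | no p≢z   = u , trans (Bp p p≢z) eq
      snd : ∀ {p u} → B p ≡ just u → canon p ≡ just u
      snd {p} eq with p ≟ₚ z
      ... | yes refl = trans unique (trans (sym Bz) eq)
      ... | no p≢z   = sound con (trans (sym (Bp p p≢z)) eq)
      cls : ∀ {p u} d → B p ≡ just u → inward d (glue u d) ≡ true → InDom B (p ⊕ d)
      cls {p} d eq in! with p ≟ₚ z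
      ... | no p≢z   = mono (closed con d (trans (sym (Bp p p≢z)) eq) in!)
      ... | yes refl with just-injective (trans (sym Bz) eq)
      ...   | refl = mono (proj₁ (input d in!))

  seed-consistent : ∀ {A} → (∀ p → A p ≡ seedAsm system p) → Consistent A
  seed-consistent {A} eqs = record { sound = snd ; closed = cls ; seeded = seedTile , trans (eqs origin) at-origin }
    where
    at-origin : seedAsm system origin ≡ just seedTile
    at-origin with origin ≟ₚ origin
    ... | yes _ = refl
    ... | no ne = ⊥-elim (ne refl)
    only : ∀ {p u} → seedAsm system p ≡ just u → p ≡ origin × u ≡ seedTile
    only {p} eq with p ≟ₚ origin
    only refl | yes p≡o = p≡o , refl
    snd : ∀ {p u} → A p ≡ just u → canon p ≡ just u
    snd {p} eq with only {p} (trans (sym (eqs p)) eq)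
    ... | refl , refl = start
    cls : ∀ {p u} d → A p ≡ just u → inward d (glue u d) ≡ true → InDom A (p ⊕ d)
    cls {p} d eq in! with only {p} (trans (sym (eqs p)) eq)
    ... | refl , refl = ⊥-elim (seed-outward d in!)

  respects : ∀ {A B} → (∀ p → B p ≡ A p) → Consistent A → Consistent B
  respects eqs con = record
    { sound  = λ {p} eq → sound con (trans (sym (eqs p)) eq)
    ; closed = λ {p} d eq in! → let u , eq′ = closed con d (trans (sym (eqs p)) eq) in! in u , trans (eqs _) eq′
    ; seeded = let u , eq = seeded con in u , trans (eqs _) eq }

  production-consistent : ∀ {A} → Production system A → Consistent A
  production-consistent {A} (α , α₀ , steps , union) = record
    { sound  = λ {p} {t} eq → let n , eqₙ = Equivalence.to (union p t) eq in sound (stage n) eqₙ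
    ; closed = λ {p} {t} d eq in! →
        let n , eqₙ = Equivalence.to (union p t) eq
            u , eq′ = closed (stage n) d eqₙ in!
        in u , Equivalence.from (union (p ⊕ d) u) (n , eq′)
    ; seeded = let u , eq = seeded (stage 0) in u , Equivalence.from (union origin u) (0 , eq) }
    where
    stage : ∀ n → Consistent (α n)
    stage zero = seed-consistent α₀
    stage (suc n) with steps n
    ... | inj₁ (z , t , t∈ , Az , Bz , Bp , stab) = Step.consistent (stage n) z t t∈ Az Bz Bp stab
    ... | inj₂ idle = respects idle (stage n)

  attachable : ∀ {A z t} → Consistent A → canon z ≡ just t → A z ≡ nothing →
               (∀ d → inward d (glue t d) ≡ true → InDom A (z ⊕ d)) → ∃ (Attach system A)
  attachable {A} {z} {t} con c Az ready =
    B , z , t , member c , Az , Bz , Bp , stable consistent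
    where
    B : Assembly
    B p with p ≟ₚ z
    ... | yes _ = just t
    ... | no _  = A p
    Bz : B z ≡ just t
    Bz with z ≟ₚ z
    ... | yes _ = refl
    ... | no ne = ⊥-elim (ne refl)
    Bp : ∀ p → p ≢ z → B p ≡ A p
    Bp p p≢z with p ≟ₚ z
    ... | yes p≡z = ⊥-elim (p≢z p≡z)
    ... | no _    = refl
    mono : ∀ {p} → InDom A p → InDom B p
    mono {p} (u , eq) with p ≟ₚ z
    ... | yes _ = t , refl
    ... | no _  = u , eq
    consistent : Consistent B
    consistent = record { sound = λ {p} → snd {p} ; closed = λ {p} → cls {p} ; seeded = mono {origin} (seeded con) }
      where
      snd : ∀ {p u} → B p ≡ just u → canon p ≡ just u
      snd {p} eq with p ≟ₚ z
      ... | no _ = sound con eq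
      snd refl | yes refl = c
      cls : ∀ {p u} d → B p ≡ just u → inward d (glue u d) ≡ true → InDom B (p ⊕ d)
      cls {p} d eq in! with p ≟ₚ z
      ... | no _ = mono {p ⊕ d} (closed con d eq in!)
      cls d refl in! | yes refl = mono {z ⊕ d} (ready d in!)

  -- Induction on the rank: the inputs of a missing tile come from positions of smaller rank, which
  -- are occupied, so the tile could attach.
  terminal-full : ∀ {A} → Consistent A → Terminal system A → ∀ {p t} → canon p ≡ just t → InDom A p
  terminal-full {A} con term {p} c = go c (<-wellFounded (rank p))
    where
    go : ∀ {p t} → canon p ≡ just t → Acc _<_ (rank p) → InDom A p
    go {p} {t} c (acc rs) with A p in eq
    ... | just u  = u , refl
    ... | nothing = ⊥-elim (term (attachable con c eq λ d in! →
            go (proj₂ (canon-⊕ d c in!)) (rs (descends d c in!))))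

  self-assembles : ∀ {X : Pos → Set} → (∀ p → InDom canon p ⇔ X p) → StrictlySelfAssembles system X
  self-assembles shape A prod term p = mk⇔
    (λ (t , eq) → Equivalence.to (shape p) (t , sound con eq))
    (λ x → terminal-full con term (proj₂ (Equivalence.from (shape p) x)))
    where con = production-consistent prod

-- Base 6 digits and the order of growth

≡ᵇ⇒≡ : ∀ m n → (m ≡ᵇ n) ≡ true → m ≡ n
≡ᵇ⇒≡ m n eq = ℕ.≡ᵇ⇒≡ m n (subst Bool.T (sym eq) _)

data Carry (x : ℕ) : Set where
  within : x % 6 < 5 → suc x % 6 ≡ suc (x % 6) → suc x / 6 ≡ x / 6 → Carry x
  across : x % 6 ≡ 5 → suc x % 6 ≡ 0 → suc x / 6 ≡ suc (x / 6) → Carry x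

carry : ∀ x → Carry x
carry x with x % 6 ℕ.≟ 5
... | no ≢5 = within r<5
  (trans (cong (_% 6) split) (trans ([m+kn]%n≡m%n (suc (x % 6)) (x / 6) 6) (m<n⇒m%n≡m (s≤s r<5))))
  (trans (cong (_/ 6) split) (trans (+-distrib-/ (suc (x % 6)) (x / 6 * 6) small)
    (cong₂ _+_ (m<n⇒m/n≡0 (s≤s r<5)) (m*n/n≡m (x / 6) 6))))
  where
  r<5 : x % 6 < 5
  r<5 = ℕ.≤∧≢⇒< (ℕ.≤-pred (m%n<n x 6)) ≢5
  split : suc x ≡ suc (x % 6) + x / 6 * 6
  split = cong suc (m≡m%n+[m/n]*n x 6)
  small : suc (x % 6) % 6 + x / 6 * 6 % 6 < 6
  small = subst (_< 6) (sym (trans (cong₂ _+_ (m<n⇒m%n≡m (s≤s r<5)) (m*n%n≡0 (x / 6) 6)) (ℕ.+-identityʳ _))) (s≤s r<5)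
... | yes ≡5 = across ≡5
  (trans (cong (_% 6) split) (m*n%n≡0 (suc (x / 6)) 6))
  (trans (cong (_/ 6) split) (m*n/n≡m (suc (x / 6)) 6))
  where
  split : suc x ≡ suc (x / 6) * 6
  split = cong suc (trans (m≡m%n+[m/n]*n x 6) (cong (_+ x / 6 * 6) ≡5))

/6-< : ∀ x → x % 6 ≡ 5 → x / 6 < x
/6-< (suc x) _ = m/n<m (suc x) 6 (s≤s (s≤s z≤n))

-- Dropping a digit of both coordinates lowers their sum unless both vanish, so x + y bounds the
-- number of levels a recursion needs.
/6-sum-≤ : ∀ {n} x y → x + y ≤ suc n → x / 6 + y / 6 ≤ n
/6-sum-≤ zero zero _ = z≤n
/6-sum-≤ zero (suc y) le = ℕ.≤-pred (ℕ.≤-trans (m/n<m (suc y) 6 (s≤s (s≤s z≤n))) le)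
/6-sum-≤ (suc x) y le = ℕ.≤-pred (ℕ.≤-trans (ℕ.+-mono-<-≤ (m/n<m (suc x) 6 (s≤s (s≤s z≤n))) (m/n≤m y 6)) le)

/6-sum-< : ∀ {n} x y → x + y < suc (suc n) → x / 6 + y / 6 < suc n
/6-sum-< x y (s≤s le) = s≤s (/6-sum-≤ x y le)

-- M: the tile needs no input from the north or the east; T: it belongs to a top row that
-- is filled westward; R: to a right column that is filled southward.
data Part : Set where
  M T R : Part

tag : Part → ℕ
tag M = 0
tag T = 1
tag R = 1

tag≤1 : ∀ p → tag p ≤ 1
tag≤1 M = z≤n
tag≤1 T = s≤s z≤n
tag≤1 R = s≤s z≤n

-- The part of the parent block to which a part of its child (i , j) belongs.
up : ℕ → ℕ → Part → Part
up i j M = M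
up i j T = if j ≡ᵇ 5 then T else M
up i j R = if i ≡ᵇ 5 then R else M

-- The last argument is the part of the parent. In `M` the antidiagonal decides, and the factor 3
-- leaves room for the tag; a top row grows westward, so there the index falls with i.
index : ℕ → ℕ → Part → Part → ℕ
index i j p M = 3 * (i + j) + tag p
index i j p T = 5 ∸ i
index i j p R = 5 ∸ j

-- The tiles are ordered lexicographically by the positions of their blocks of decreasing size:
-- blocks are filled from south-west to north-east, and the top row of a block after the rest of it.
rank : ℕ → ℕ → ℕ → Part → ℕ
rank zero    x y p = tag p
rank (suc n) x y p = index (x % 6) (y % 6) p (up (x % 6) (y % 6) p)
                     + rank n (x / 6) (y / 6) (up (x % 6) (y % 6) p) * 32

flip : Part → Part
flip M = M
flip T = R
flip R = T

tag-flip : ∀ p → tag (flip p) ≡ tag p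
tag-flip M = refl
tag-flip T = refl
tag-flip R = refl

flip-flip : ∀ p → flip (flip p) ≡ p
flip-flip M = refl
flip-flip T = refl
flip-flip R = refl

up-flip : ∀ i j p → up i j (flip p) ≡ flip (up j i p)
up-flip i j M = refl
up-flip i j T with i ≡ᵇ 5
... | true  = refl
... | false = refl
up-flip i j R with j ≡ᵇ 5
... | true  = refl
... | false = refl

index-flip : ∀ i j p q → index i j (flip p) (flip q) ≡ index j i p q
index-flip i j p M = cong₂ (λ s t → 3 * s + t) (ℕ.+-comm i j) (tag-flip p)
index-flip i j p T = refl
index-flip i j p R = refl

-- Reflection in the diagonal exchanges top rows and right columns; it transfers statements about
-- the east to the north.
rank-flip : ∀ n x y p → rank n x y (flip p) ≡ rank n y x p
rank-flip zero x y p = tag-flip p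
rank-flip (suc n) x y p rewrite up-flip (x % 6) (y % 6) p =
  cong₂ (λ a b → a + b * 32) (index-flip (x % 6) (y % 6) p (up (y % 6) (x % 6) p))
                             (rank-flip n (x / 6) (y / 6) (up (y % 6) (x % 6) p))

-- The largest value is 3 * (5 + 5) + 1 = 31, hence the base 32 of `rank`.
index<32 : ∀ {i j} p q → i < 6 → j < 6 → index i j p q < 32
index<32 {i} {j} p M (s≤s i≤5) (s≤s j≤5) = s≤s (ℕ.+-mono-≤ (ℕ.*-monoʳ-≤ 3 (ℕ.+-mono-≤ i≤5 j≤5)) (tag≤1 p))
index<32 {i} {j} p T _ _ = ℕ.≤-trans (s≤s (ℕ.m∸n≤m 5 i)) (ℕ.m≤m+n 6 26)
index<32 {i} {j} p R _ _ = ℕ.≤-trans (s≤s (ℕ.m∸n≤m 5 j)) (ℕ.m≤m+n 6 26)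

lex-< : ∀ {a b r s} → a < 32 → r < s → a + r * 32 < b + s * 32
lex-< {a} {b} {r} {s} a<32 r<s = begin-strict
  a + r * 32   <⟨ ℕ.+-monoˡ-< (r * 32) a<32 ⟩
  suc r * 32   ≤⟨ ℕ.*-monoˡ-≤ 32 r<s ⟩
  s * 32       ≤⟨ ℕ.m≤n+m (s * 32) b ⟩
  b + s * 32   ∎
  where open ℕ.≤-Reasoning

rank-step : ∀ n x y p x′ y′ p′ →
            rank n (x / 6) (y / 6) (up (x % 6) (y % 6) p) < rank n (x′ / 6) (y′ / 6) (up (x′ % 6) (y′ % 6) p′) →
            rank (suc n) x y p < rank (suc n) x′ y′ p′
rank-step n x y p x′ y′ p′ = lex-< {b = index (x′ % 6) (y′ % 6) p′ (up (x′ % 6) (y′ % 6) p′)} (index<32 p (up (x % 6) (y % 6) p) (m%n<n x 6) (m%n<n y 6))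

rank-M-< : ∀ n x y p → p ≢ M → rank n x y M < rank n x y p
rank-M-< n x y M p≢M = ⊥-elim (p≢M refl)
rank-M-< zero x y T _ = s≤s z≤n
rank-M-< zero x y R _ = s≤s z≤n
rank-M-< (suc n) x y T _ with y % 6 ≡ᵇ 5 | rank-M-< n (x / 6) (y / 6) T (λ ())
... | true  | ih = lex-< {b = 5 ∸ x % 6} (index<32 M M (m%n<n x 6) (m%n<n y 6)) ih
... | false | _  = ℕ.+-monoˡ-< _ (ℕ.+-monoʳ-< (3 * (x % 6 + y % 6)) (s≤s z≤n))
rank-M-< (suc n) x y R _ with x % 6 ≡ᵇ 5 | rank-M-< n (x / 6) (y / 6) R (λ ())
... | true  | ih = lex-< {b = 5 ∸ y % 6} (index<32 M M (m%n<n x 6) (m%n<n y 6)) ih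
... | false | _  = ℕ.+-monoˡ-< _ (ℕ.+-monoʳ-< (3 * (x % 6 + y % 6)) (s≤s z≤n))

up-<5 : ∀ i j p → i < 5 → p ≢ T → up i j p ≡ M
up-<5 i j M _ _ = refl
up-<5 i j T _ p≢T = ⊥-elim (p≢T refl)
up-<5 i j R i<5 _ with i ≡ᵇ 5 in eq
... | false = refl
... | true  = ⊥-elim (ℕ.<⇒≢ i<5 (≡ᵇ⇒≡ i 5 eq))

up-≢T : ∀ i j p → p ≢ T → up i j p ≢ T
up-≢T i j M _ ()
up-≢T i j T p≢T _ = p≢T refl
up-≢T i j R _ eq with i ≡ᵇ 5
up-≢T i j R _ () | true
up-≢T i j R _ () | false

-- Inside one parent either i + j grows or `rank-M-<` decides one level up; across a border the
-- claim passes to the parents. The bound keeps the recursion away from level 0, where only tags are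
-- left.
rank-east : ∀ n x y p q → x + y < n → p ≢ T → rank n x y p < rank n (suc x) y q
rank-east (suc n) x y p q bound p≢T with carry x
... | within r<5 %eq /eq rewrite %eq | /eq | up-<5 (x % 6) (y % 6) p r<5 p≢T
    with up (suc (x % 6)) (y % 6) q in eq
...   | M = ℕ.+-monoˡ-< _ (begin-strict
      3 * (x % 6 + y % 6) + tag p  ≤⟨ ℕ.+-monoʳ-≤ (3 * (x % 6 + y % 6)) (tag≤1 p) ⟩
      3 * (x % 6 + y % 6) + 1      <⟨ ℕ.+-monoʳ-< (3 * (x % 6 + y % 6)) (s≤s (s≤s z≤n)) ⟩
      3 * (x % 6 + y % 6) + 3      ≡⟨ trans (ℕ.+-comm _ 3) (sym (ℕ.*-suc 3 (x % 6 + y % 6))) ⟩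
      3 * (suc (x % 6) + y % 6)    ≤⟨ ℕ.m≤m+n _ (tag q) ⟩
      3 * (suc (x % 6) + y % 6) + tag q ∎)
      where
      open ℕ.≤-Reasoning
...   | T = lex-< {b = 5 ∸ suc (x % 6)} (index<32 p M (m%n<n x 6) (m%n<n y 6)) (rank-M-< n (x / 6) (y / 6) T λ ())
...   | R = lex-< {b = 5 ∸ y % 6} (index<32 p M (m%n<n x 6) (m%n<n y 6)) (rank-M-< n (x / 6) (y / 6) R λ ())
rank-east (suc n) x y p q (s≤s bound) p≢T | across r≡5 %eq /eq =
  rank-step n x y p (suc x) y q (subst (λ z → rank n (x / 6) (y / 6) (up (x % 6) (y % 6) p) < rank n z (y / 6) (up (suc x % 6) (y % 6) q)) (sym /eq)
    (rank-east n (x / 6) (y / 6) _ _ bound′ (up-≢T (x % 6) (y % 6) p p≢T)))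
  where
  bound′ : x / 6 + y / 6 < n
  bound′ = ℕ.≤-trans (ℕ.+-mono-<-≤ (/6-< x r≡5) (m/n≤m y 6)) bound

rank-north : ∀ n x y p q → x + y < n → p ≢ R → rank n x y p < rank n x (suc y) q
rank-north n x y p q bound p≢R = subst₂ _<_ (rank-flip n y x p) (rank-flip n (suc y) x q)
  (rank-east n y x (flip p) (flip q) (subst (_< n) (ℕ.+-comm x y) bound)
    λ eq → p≢R (trans (sym (flip-flip p)) (cong flip eq)))

-- Rev n x y says that block (x , y) of level n passes its top row's label to the west.
module _ (Rev : ℕ → ℕ → ℕ → Set)
         (rev-row : ∀ {n x y} → Rev (suc n) x y → y % 6 ≡ 5)
         (rev-up  : ∀ {n x y} → Rev (suc n) x y → x % 6 ≡ 5 → Rev n (x / 6) (y / 6)) where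

  rank-west : ∀ n x y → x + y < n → Rev n x y → rank n (suc x) y T < rank n x y T
  rank-west (suc n) x y bound rev with carry x
  ... | within r<5 %eq /eq rewrite %eq | /eq | rev-row rev =
    ℕ.+-monoˡ-< (rank n (x / 6) (y / 6) T * 32) (ℕ.∸-monoʳ-< (ℕ.n<1+n (x % 6)) r<5)
  rank-west (suc n) x y (s≤s bound) rev | across r≡5 %eq /eq rewrite %eq | /eq | rev-row rev =
    lex-< {b = 5 ∸ x % 6} (s≤s (ℕ.m≤m+n 5 26)) (rank-west n (x / 6) (y / 6) bound′ (rev-up rev r≡5))
    where
    bound′ : x / 6 + y / 6 < n
    bound′ = ℕ.≤-trans (ℕ.+-mono-<-≤ (/6-< x r≡5) (m/n≤m y 6)) bound

-- Both tiles have the same parent block, counted once as `M` and once as `T`. This is the place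
-- where a westward label starts.
rank-corner : ∀ n x y → suc x % 6 ≢ 0 → y % 6 ≡ 5 → rank (suc n) (suc x) y M < rank (suc n) x y T
rank-corner n x y ≢0 y≡5 with carry x
... | across _ %eq _ = ⊥-elim (≢0 %eq)
... | within _ %eq /eq = rank-step n (suc x) y M x y T
  (subst₂ (λ a j → rank n a (y / 6) M < rank n (x / 6) (y / 6) (up (x % 6) j T)) (sym /eq) (sym y≡5)
    (rank-M-< n (x / 6) (y / 6) T λ ()))

-- On a leading pair of zero digits the index is just the tag, which is the rank at level 0.
rank-stable : ∀ n x y p → x + y < n → rank (suc n) x y p ≡ rank n x y p
rank-stable (suc zero) zero zero M _ = refl
rank-stable (suc zero) zero zero T _ = refl
rank-stable (suc zero) zero zero R _ = refl
rank-stable (suc zero) zero (suc y) p (s≤s ())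
rank-stable (suc zero) (suc x) y p (s≤s ())
rank-stable (suc (suc n)) x y p bound =
  cong (λ r → index (x % 6) (y % 6) p (up (x % 6) (y % 6) p) + r * 32)
       (rank-stable (suc n) (x / 6) (y / 6) (up (x % 6) (y % 6) p) (/6-sum-< x y bound))

-- The pattern `K` as a grid with a hole

mid : ℕ → Bool
mid a = (a ≡ᵇ 2) ∨ (a ≡ᵇ 3)

hole : ℕ → ℕ → Bool
hole a b = mid a ∧ mid b

mid-true : ∀ a → mid a ≡ true → 2 ≤ a × a ≤ 3
mid-true 2 _ = s≤s (s≤s z≤n) , s≤s (s≤s z≤n)
mid-true 3 _ = s≤s (s≤s z≤n) , s≤s (s≤s (s≤s z≤n))

mid-false : ∀ a → mid a ≡ false → ¬ (2 ≤ a × a ≤ 3)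
mid-false (suc (suc (suc (suc a)))) _ (_ , s≤s (s≤s (s≤s ())))
mid-false 1 _ (s≤s () , _)

∈-K : ∀ {a b} → a < 6 → b < 6 → hole a b ≡ false → (a , b) ∈ K
∈-K {a} {b} a<6 b<6 solid = ∈-filter⁺ (λ p → ¬? (inCenter? p)) (∈-cartesianProduct⁺ (∈-upTo⁺ a<6) (∈-upTo⁺ b<6)) outside
  where
  outside : ¬ ((2 ≤ a × a ≤ 3) × (2 ≤ b × b ≤ 3))
  outside (ma , mb) with mid a in eqa | mid b in eqb
  ... | false | _     = mid-false a eqa ma
  ... | true  | false = mid-false b eqb mb

∈-K⁻ : ∀ {a b} → (a , b) ∈ K → hole a b ≡ false
∈-K⁻ {a} {b} ∈K with mid a in eqa | mid b in eqb
... | false | _     = refl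
... | true  | false = refl
... | true  | true  = ⊥-elim (proj₂ (∈-filter⁻ (λ p → ¬? (inCenter? p)) {xs = cartesianProduct (upTo 6) (upTo 6)} ∈K) (mid-true a eqa , mid-true b eqb))

-- The assembly generated by a substitution on blocks

module Substitution
  (State : Set) (root : State) (child : State → ℕ → ℕ → State) (side : Dir → State → ℕ)
  (column row : State → ℕ)
  where

  sideOf : Dir → Maybe State → ℕ
  sideOf d nothing  = 0
  sideOf d (just s) = side d s

  expand : Maybe State → ℕ → ℕ → Maybe State
  expand nothing  a b = nothing
  expand (just s) a b = if hole a b then nothing else just (child s a b)

  part : State → Part
  part s = if backward (side E s) then T else if backward (side N s) then R else M

  toTile : State → Tile
  toTile s = tile (side N s) (side E s) (side S s) (side W s)

  -- Level 0 is `root` everywhere, so the value is the intended one only if n digits suffice to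
  -- write x and y.
  cell : ℕ → ℕ → ℕ → Maybe State
  cell zero    x y = just root
  cell (suc n) x y = expand (cell n (x / 6) (y / 6)) (x % 6) (y % 6)

  glue-toTile : ∀ d m → glueAt (Maybe.map toTile m) d ≡ sideOf d m
  glue-toTile d nothing  = refl
  glue-toTile N (just _) = refl
  glue-toTile E (just _) = refl
  glue-toTile S (just _) = refl
  glue-toTile W (just _) = refl

  glue-side : ∀ d s → glue (toTile s) d ≡ side d s
  glue-side d s = glue-toTile d (just s)

  module Grow
    (Good : State → Set)
    (good-root  : Good root)
    (good-child : ∀ {s a b} → Good s → a < 6 → b < 6 → hole a b ≡ false → Good (child s a b))
    (child-root : child root 0 0 ≡ root)
    (root-W : side W root ≡ 0) (root-S : side S root ≡ 0)
    (inner-E : ∀ {s a b} → Good s → a < 5 → b < 6 →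
               sideOf E (expand (just s) a b) ≡ sideOf W (expand (just s) (suc a) b))
    (inner-N : ∀ {s a b} → Good s → a < 6 → b < 5 →
               sideOf N (expand (just s) a b) ≡ sideOf S (expand (just s) a (suc b)))
    (seam-E : ∀ {m m′ b} → (∀ {s} → m ≡ just s → Good s) → (∀ {s} → m′ ≡ just s → Good s) → b < 6 →
              sideOf E m ≡ sideOf W m′ → sideOf E (expand m 5 b) ≡ sideOf W (expand m′ 0 b))
    (seam-N : ∀ {m m′ a} → (∀ {s} → m ≡ just s → Good s) → (∀ {s} → m′ ≡ just s → Good s) → a < 6 →
              sideOf N m ≡ sideOf S m′ → sideOf N (expand m a 5) ≡ sideOf S (expand m′ a 0))
    (revE revN : State → Bool)
    (backward-E : ∀ {s} → backward (side E s) ≡ true → revE s ≡ true)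
    (backward-N : ∀ {s} → backward (side N s) ≡ true → revN s ≡ true)
    (column-child : ∀ s a b → column (child s a b) ≡ a) (row-child : ∀ s a b → row (child s a b) ≡ b)
    (revE-row : ∀ {s} → Good s → revE s ≡ true → row s ≡ 5)
    (revN-column : ∀ {s} → Good s → revN s ≡ true → column s ≡ 5)
    (revE-child : ∀ {s} → Good s → revE (child s 5 5) ≡ true → revE s ≡ true)
    (revN-child : ∀ {s} → Good s → revN (child s 5 5) ≡ true → revN s ≡ true)
    (backward-W : ∀ {s} → Good s → backward (side W s) ≡ true → part s ≡ T ⊎ (part s ≡ M × column s ≢ 0 × row s ≡ 5))
    (backward-S : ∀ {s} → Good s → backward (side S s) ≡ true → part s ≡ R ⊎ (part s ≡ M × row s ≢ 0 × column s ≡ 5))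
    (backward-N-R : ∀ {s} → Good s → backward (side N s) ≡ true → part s ≡ R)
    (inputs-state : ∀ {s} → Good s → inputStrength (toTile s) ≡ 2 ⊎ s ≡ root)
    (root-child : ∀ {s} → Good s → child s 0 0 ≡ root → s ≡ root)
    (inputs-root : inputStrength (toTile root) ≡ 0)
    where

    data Parent (n x y : ℕ) (s : State) : Set where
      parent : ∀ {r} → cell n (x / 6) (y / 6) ≡ just r → Good r → hole (x % 6) (y % 6) ≡ false →
               s ≡ child r (x % 6) (y % 6) → Parent n x y s

    good-cell : ∀ n x y {s} → cell n x y ≡ just s → Good s
    parent-of : ∀ n x y {s} → cell (suc n) x y ≡ just s → Parent n x y s

    good-cell zero x y refl = good-root
    good-cell (suc n) x y eq with parent-of n x y eq
    ... | parent _ g solid refl = good-child g (m%n<n x 6) (m%n<n y 6) solid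

    parent-of n x y eq with cell n (x / 6) (y / 6) in eqr
    ... | just r with hole (x % 6) (y % 6) in solid
    parent-of n x y refl | just r | false = parent eqr (good-cell n (x / 6) (y / 6) eqr) solid refl

    column-cell : ∀ n x y {s} → cell (suc n) x y ≡ just s → column s ≡ x % 6
    column-cell n x y eq with parent-of n x y eq
    ... | parent {r} _ _ _ refl = column-child r (x % 6) (y % 6)

    row-cell : ∀ n x y {s} → cell (suc n) x y ≡ just s → row s ≡ y % 6
    row-cell n x y eq with parent-of n x y eq
    ... | parent {r} _ _ _ refl = row-child r (x % 6) (y % 6)

    cell-stable : ∀ n x y → x + y ≤ n → cell (suc n) x y ≡ cell n x y
    cell-stable zero zero zero _ = cong just child-root
    cell-stable (suc n) x y bound =
      cong (λ m → expand m (x % 6) (y % 6)) (cell-stable n (x / 6) (y / 6) (/6-sum-≤ x y bound))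

    east : ∀ n x y → x + y < n → sideOf E (cell n x y) ≡ sideOf W (cell n (suc x) y)
    east (suc n) x y bound with carry x
    ... | within r<5 %eq /eq rewrite %eq | /eq with cell n (x / 6) (y / 6) in eqr
    ...   | nothing = refl
    ...   | just r  = inner-E (good-cell n (x / 6) (y / 6) eqr) r<5 (m%n<n y 6)
    east (suc n) x y (s≤s bound) | across r≡5 %eq /eq rewrite r≡5 | %eq | /eq =
      seam-E (good-cell n (x / 6) (y / 6)) (good-cell n (suc (x / 6)) (y / 6)) (m%n<n y 6)
        (east n (x / 6) (y / 6) (ℕ.≤-trans (ℕ.+-mono-<-≤ (/6-< x r≡5) (m/n≤m y 6)) bound))

    north : ∀ n x y → x + y < n → sideOf N (cell n x y) ≡ sideOf S (cell n x (suc y))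
    north (suc n) x y bound with carry y
    ... | within r<5 %eq /eq rewrite %eq | /eq with cell n (x / 6) (y / 6) in eqr
    ...   | nothing = refl
    ...   | just r  = inner-N (good-cell n (x / 6) (y / 6) eqr) (m%n<n x 6) r<5
    north (suc n) x y (s≤s bound) | across r≡5 %eq /eq rewrite r≡5 | %eq | /eq =
      seam-N (good-cell n (x / 6) (y / 6)) (good-cell n (x / 6) (suc (y / 6))) (m%n<n x 6)
        (north n (x / 6) (y / 6) (ℕ.≤-trans (ℕ.+-mono-≤-< (m/n≤m x 6) (/6-< y r≡5)) bound))

    -- The outside of the quadrant acts as an empty block: the seam between `nothing` and a block
    -- with western glue 0 reproduces the glue 0.
    west-border : ∀ n y → sideOf W (cell n 0 y) ≡ 0
    west-border zero    y = root-W
    west-border (suc n) y = sym (seam-E {m = nothing} (λ ()) (good-cell n 0 (y / 6)) (m%n<n y 6)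
                                        (sym (west-border n (y / 6))))

    south-border : ∀ n x → sideOf S (cell n x 0) ≡ 0
    south-border zero    x = root-S
    south-border (suc n) x = sym (seam-N {m = nothing} (λ ()) (good-cell n (x / 6) 0) (m%n<n x 6)
                                         (sym (south-border n (x / 6))))

    power⇒cell : ∀ i n x y → power K i (x , y) → ∃ λ s → cell n x y ≡ just s
    power⇒cell i       zero    x y _ = root , refl
    power⇒cell zero    (suc n) _ _ refl with power⇒cell zero n 0 0 refl
    ... | s , eq = child s 0 0 , cong (λ m → expand m 0 0) eq
    power⇒cell (suc i) (suc n) x y (up , ∈K) with power⇒cell i n (x / 6) (y / 6) up
    ... | s , eq rewrite eq | ∈-K⁻ ∈K = child s (x % 6) (y % 6) , refl

    cell⇒power : ∀ n x y {s} → x + y ≤ n → cell n x y ≡ just s → power K n (x , y)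
    cell⇒power zero zero zero _ _ = refl
    cell⇒power (suc n) x y bound eq with parent-of n x y eq
    ... | parent eqr _ solid _ =
      cell⇒power n (x / 6) (y / 6) (/6-sum-≤ x y bound) eqr , ∈-K (m%n<n x 6) (m%n<n y 6) solid

    -- suc (x + y) digits are enough to write x and y with a leading zero.
    canonState : Pos → Maybe State
    canonState (+ x , + y) = cell (suc (x + y)) x y
    canonState _           = nothing

    canon : Pos → Maybe Tile
    canon p = Maybe.map toTile (canonState p)

    rankState : Pos → Maybe State → ℕ
    rankState (+ x , + y) (just s) = rank (suc (x + y)) x y (part s)
    rankState _ _ = 0

    rankOf : Pos → ℕ
    rankOf p = rankState p (canonState p)

    canon-shape : ∀ p → InDom canon p ⇔ FractalShape K p
    canon-shape p = mk⇔ to (λ (q , eq , i , pow) → from q eq i pow)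
      where
      to : ∀ {p} → InDom canon p → FractalShape K p
      to {+ x , + y} (t , eq) with cell (suc (x + y)) x y in eqs
      ... | just s = (x , y) , refl , suc (x + y) , cell⇒power (suc (x + y)) x y (ℕ.n≤1+n _) eqs
      from : ∀ {p} q → p ≡ (+ proj₁ q , + proj₂ q) → ∀ i → power K i q → InDom canon p
      from (x , y) refl i pow with power⇒cell i (suc (x + y)) x y pow
      ... | s , eq = toTile s , cong (Maybe.map toTile) eq

    sideOf-canon : ∀ p d → glueAt (canon p) d ≡ sideOf d (canonState p)
    sideOf-canon p d = glue-toTile d (canonState p)

    eastPos : ∀ x y → sideOf E (canonState (+ x , + y)) ≡ sideOf W (canonState (+ suc x , + y))
    eastPos x y = trans (cong (sideOf E) (sym (cell-stable (suc (x + y)) x y (ℕ.n≤1+n _))))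
                        (east (suc (suc (x + y))) x y (s≤s (ℕ.n≤1+n _)))

    northPos : ∀ x y → sideOf N (canonState (+ x , + y)) ≡ sideOf S (canonState (+ x , + suc y))
    northPos x y rewrite ℕ.+-suc x y =
      trans (cong (sideOf N) (sym (cell-stable (suc (x + y)) x y (ℕ.n≤1+n _))))
            (north (suc (suc (x + y))) x y (s≤s (ℕ.n≤1+n _)))

    data Coord : ℤ → Set where
      nonneg : ∀ n → Coord (+ n)
      minus1 : Coord -[1+ 0 ]
      below  : ∀ n → Coord -[1+ suc n ]

    coord : ∀ i → Coord i
    coord (+ n)          = nonneg n
    coord -[1+ zero ]    = minus1
    coord -[1+ (suc n) ] = below n

    west-edge : ∀ i j → sideOf E (canonState (i , j)) ≡ sideOf W (canonState (i ℤ.+ + 1 , j))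
    west-edge i -[1+ n ] = trans (outside i) (sym (outside′ (i ℤ.+ + 1)))
      where
      outside : ∀ i → sideOf E (canonState (i , -[1+ n ])) ≡ 0
      outside (+ _)    = refl
      outside -[1+ _ ] = refl
      outside′ : ∀ i → sideOf W (canonState (i , -[1+ n ])) ≡ 0
      outside′ (+ _)    = refl
      outside′ -[1+ _ ] = refl
    west-edge i (+ y) with coord i
    ... | nonneg x rewrite ℕ.+-comm x 1 = eastPos x y
    ... | minus1  = sym (west-border (suc y) y)
    ... | below n = refl

    south-edge : ∀ i j → sideOf N (canonState (i , j)) ≡ sideOf S (canonState (i , j ℤ.+ + 1))
    south-edge -[1+ n ] j = refl
    south-edge (+ x) j with coord j
    ... | nonneg y rewrite ℕ.+-comm y 1 = northPos x y
    ... | minus1  = sym (south-border (suc (x + 0)) x)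
    ... | below n = refl

    adjacent : ∀ p d → glueAt (canon p) d ≡ glueAt (canon (p ⊕ d)) (opp d)
    adjacent p d = trans (sideOf-canon p d) (trans (go p d) (sym (sideOf-canon (p ⊕ d) (opp d))))
      where
      goE : ∀ p → sideOf E (canonState p) ≡ sideOf W (canonState (p ⊕ E))
      goE (i , j) = trans (west-edge i j) (cong (λ k → sideOf W (canonState (i ℤ.+ + 1 , k))) (sym (ℤ.+-identityʳ j)))
      goN : ∀ p → sideOf N (canonState p) ≡ sideOf S (canonState (p ⊕ N))
      goN (i , j) = trans (south-edge i j) (cong (λ k → sideOf S (canonState (k , j ℤ.+ + 1))) (sym (ℤ.+-identityʳ i)))
      go : ∀ p d → sideOf d (canonState p) ≡ sideOf (opp d) (canonState (p ⊕ d))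
      go p E = goE p
      go p N = goN p
      go p W = trans (cong (sideOf W ∘ canonState) (sym (⊕-opp p W))) (sym (goE (p ⊕ W)))
      go p S = trans (cong (sideOf S ∘ canonState) (sym (⊕-opp p S))) (sym (goN (p ⊕ S)))

    -- `root` is its own child (0 , 0), so its last digits are 0, and `root-child` makes its parent
    -- `root` as well.
    only-root : ∀ n x y → x + y ≤ n → cell n x y ≡ just root → x ≡ 0 × y ≡ 0
    only-root zero zero zero _ _ = refl , refl
    only-root (suc n) x y bound eq with parent-of n x y eq
    ... | parent {r} eqr g _ root≡ = zero-digits x x%6≡0 (proj₁ above) , zero-digits y y%6≡0 (proj₂ above)
      where
      x%6≡0 : x % 6 ≡ 0
      x%6≡0 = trans (sym (column-cell n x y eq)) (trans (cong column (sym child-root)) (column-child root 0 0))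
      y%6≡0 : y % 6 ≡ 0
      y%6≡0 = trans (sym (row-cell n x y eq)) (trans (cong row (sym child-root)) (row-child root 0 0))
      r≡root : r ≡ root
      r≡root = root-child g (trans (sym (cong₂ (child r) x%6≡0 y%6≡0)) (sym root≡))
      above : x / 6 ≡ 0 × y / 6 ≡ 0
      above = only-root n (x / 6) (y / 6) (/6-sum-≤ x y bound) (trans eqr (cong just r≡root))
      zero-digits : ∀ x → x % 6 ≡ 0 → x / 6 ≡ 0 → x ≡ 0
      zero-digits x %≡0 /≡0 = trans (m≡m%n+[m/n]*n x 6) (cong₂ (λ r q → r + q * 6) %≡0 /≡0)

    origin : Pos
    origin = (+ 0 , + 0)

    -- Equal tiles need not come from equal states; the state is recognised by its input strength 0.
    seed-once : ∀ {p} → canon p ≡ just (toTile root) → p ≡ origin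
    seed-once {+ x , + y} eq with cell (suc (x + y)) x y in eqs
    ... | just s with inputs-state (good-cell (suc (x + y)) x y eqs)
    ...   | inj₁ two = case trans (sym two) (trans (cong inputStrength (just-injective eq)) inputs-root) of λ ()
    ...   | inj₂ refl with only-root (suc (x + y)) x y (ℕ.n≤1+n _) eqs
    ...     | refl , refl = refl

    start : canon origin ≡ just (toTile root)
    start = cong (just ∘ toTile) child-root

    -- Inputs come from tiles of smaller rank

    neighbour : ∀ {d g} m → sideOf d m ≡ g → strength g ≢ 0 → ∃ λ s → m ≡ just s × side d s ≡ g
    neighbour nothing  refl pos = ⊥-elim (pos refl)
    neighbour (just s) eq   pos = s , refl , eq

    part-T : ∀ {s} → backward (side E s) ≡ true → part s ≡ T
    part-T eq rewrite eq = refl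

    part-≢T : ∀ {s} → backward (side E s) ≡ false → part s ≢ T
    part-≢T {s} eq eq′ rewrite eq with backward (side N s)
    part-≢T eq () | true
    part-≢T eq () | false

    part-≢R : ∀ {s} → backward (side N s) ≡ false → part s ≢ R
    part-≢R {s} eq eq′ with backward (side E s)
    part-≢R eq () | true
    ... | false rewrite eq = case eq′ of λ ()

    forward : ∀ {a b} → not a ∧ b ≡ true → a ≡ false
    forward {false} _ = refl

    backward-first : ∀ {a b} → a ∧ b ≡ true → a ≡ true
    backward-first {true} _ = refl

    rankOf-just : ∀ x y {s} → canonState (+ x , + y) ≡ just s → rankOf (+ x , + y) ≡ rank (suc (x + y)) x y (part s)
    rankOf-just x y eq rewrite eq = refl

    rankOf-suc : ∀ x y {s} → canonState (+ x , + y) ≡ just s →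
                 rankOf (+ x , + y) ≡ rank (suc (suc (x + y))) x y (part s)
    rankOf-suc x y {s} eq = trans (rankOf-just x y eq) (sym (rank-stable (suc (x + y)) x y (part s) ℕ.≤-refl))

    canon-suc : ∀ x y → canonState (+ x , + y) ≡ cell (suc (suc (x + y))) x y
    canon-suc x y = sym (cell-stable (suc (x + y)) x y (ℕ.n≤1+n _))

    descend-W : ∀ x y {s} → canonState (+ x , + y) ≡ just s → inward W (side W s) ≡ true →
                ∃ λ x′ → x ≡ suc x′ × rankOf (+ x′ , + y) < rankOf (+ x , + y)
    descend-W zero y {s} eq in! =
      ⊥-elim (inward⇒strength W (side W s) in! (cong strength (trans (sym (cong (sideOf W) eq)) (west-border (suc y) y))))
    descend-W (suc x) y {s} eq in! with neighbour {E} {side W s} (canonState (+ x , + y))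
      (trans (eastPos x y) (cong (sideOf W) eq)) (inward⇒strength W (side W s) in!)
    ... | s′ , eq′ , match = x , refl ,
      subst₂ _<_ (sym (rankOf-suc x y eq′)) (sym (rankOf-just (suc x) y eq))
        (rank-east (suc (suc (x + y))) x y (part s′) (part s) (s≤s (ℕ.n≤1+n _))
          (part-≢T {s′} (trans (cong backward match) (forward in!))))

    descend-S : ∀ x y {s} → canonState (+ x , + y) ≡ just s → inward S (side S s) ≡ true →
                ∃ λ y′ → y ≡ suc y′ × rankOf (+ x , + y′) < rankOf (+ x , + y)
    descend-S x zero {s} eq in! =
      ⊥-elim (inward⇒strength S (side S s) in! (cong strength (trans (sym (cong (sideOf S) eq)) (south-border (suc (x + 0)) x))))
    descend-S x (suc y) {s} eq in! with neighbour {N} {side S s} (canonState (+ x , + y))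
      (trans (northPos x y) (cong (sideOf S) eq)) (inward⇒strength S (side S s) in!)
    ... | s′ , eq′ , match = y , refl ,
      subst₂ _<_ (sym (rankOf-suc x y eq′))
        (trans (cong (λ n → rank (suc n) x (suc y) (part s)) (sym (ℕ.+-suc x y))) (sym (rankOf-just x (suc y) eq)))
        (rank-north (suc (suc (x + y))) x y (part s′) (part s) (s≤s (ℕ.n≤1+n _))
          (part-≢R {s′} (trans (cong backward match) (forward in!))))

    RevE : ℕ → ℕ → ℕ → Set
    RevE n x y = ∃ λ s → cell n x y ≡ just s × revE s ≡ true

    RevE-row : ∀ {n x y} → RevE (suc n) x y → y % 6 ≡ 5
    RevE-row {n} {x} {y} (s , eq , rev) =
      trans (sym (row-cell n x y eq)) (revE-row (good-cell (suc n) x y eq) rev)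

    RevE-up : ∀ {n x y} → RevE (suc n) x y → x % 6 ≡ 5 → RevE n (x / 6) (y / 6)
    RevE-up {n} {x} {y} rev@(_ , eq , rev-s) x≡5 with parent-of n x y eq
    ... | parent {r} eqr g _ refl = r , eqr , revE-child g
      (subst₂ (λ a b → revE (child r a b) ≡ true) x≡5 (RevE-row {n} {x} {y} rev) rev-s)

    -- The coordinates are swapped so that `rank-west` applies to the reflected picture.
    RevN : ℕ → ℕ → ℕ → Set
    RevN n y x = ∃ λ s → cell n x y ≡ just s × revN s ≡ true

    RevN-column : ∀ {n y x} → RevN (suc n) y x → x % 6 ≡ 5
    RevN-column {n} {y} {x} (s , eq , rev) =
      trans (sym (column-cell n x y eq)) (revN-column (good-cell (suc n) x y eq) rev)

    RevN-up : ∀ {n y x} → RevN (suc n) y x → y % 6 ≡ 5 → RevN n (y / 6) (x / 6)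
    RevN-up {n} {y} {x} rev@(_ , eq , rev-s) y≡5 with parent-of n x y eq
    ... | parent {r} eqr g _ refl = r , eqr , revN-child g
      (subst₂ (λ a b → revN (child r a b) ≡ true) (RevN-column {n} {y} {x} rev) y≡5 rev-s)

    -- The eastern neighbour either lies in the same westward row (`rank-west`) or is the tile of
    -- part `M` from which the label sets out (`rank-corner`).
    descend-E : ∀ x y {s} → canonState (+ x , + y) ≡ just s → inward E (side E s) ≡ true →
                rankOf (+ suc x , + y) < rankOf (+ x , + y)
    descend-E x y {s} eq in! with neighbour {W} {side E s} (canonState (+ suc x , + y))
      (trans (sym (eastPos x y)) (cong (sideOf E) eq)) (inward⇒strength E (side E s) in!)
    ... | s′ , eq′ , match = subst₂ _<_ (sym (rankOf-just (suc x) y eq′)) (sym (rankOf-suc x y eq))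
      (subst (λ p → rank n (suc x) y (part s′) < rank n x y p) (sym (part-T {s} back)) below-T)
      where
      n = suc (suc (x + y))
      back : backward (side E s) ≡ true
      back = backward-first in!
      below-T : rank n (suc x) y (part s′) < rank n x y T
      below-T with backward-W (good-cell n (suc x) y eq′) (trans (cong backward match) back)
      ... | inj₁ p≡T rewrite p≡T =
        rank-west RevE (λ {n} {x} {y} → RevE-row {n} {x} {y}) (λ {n} {x} {y} → RevE-up {n} {x} {y})
          n x y (s≤s (ℕ.n≤1+n _)) (s , trans (sym (canon-suc x y)) eq , backward-E back)
      ... | inj₂ (p≡M , ≢0 , y≡5) rewrite p≡M = rank-corner (suc (x + y)) x y
        (≢0 ∘ trans (column-cell (suc (x + y)) (suc x) y eq′)) (trans (sym (row-cell (suc (x + y)) (suc x) y eq′)) y≡5)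

    descend-N : ∀ x y {s} → canonState (+ x , + y) ≡ just s → inward N (side N s) ≡ true →
                rankOf (+ x , + suc y) < rankOf (+ x , + y)
    descend-N x y {s} eq in! with neighbour {S} {side N s} (canonState (+ x , + suc y))
      (trans (sym (northPos x y)) (cong (sideOf N) eq)) (inward⇒strength N (side N s) in!)
    ... | s′ , eq′ , match = subst₂ _<_
      (sym (trans (rankOf-just x (suc y) eq′) (cong (λ k → rank (suc k) x (suc y) (part s′)) (ℕ.+-suc x y))))
      (sym (rankOf-suc x y eq)) (subst (λ p → rank n x (suc y) (part s′) < rank n x y p) (sym part-s) below-R)
      where
      n = suc (suc (x + y))
      back : backward (side N s) ≡ true
      back = backward-first in!
      part-s : part s ≡ R
      part-s = backward-N-R (good-cell (suc (x + y)) x y eq) back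
      below-R : rank n x (suc y) (part s′) < rank n x y R
      below-R with backward-S (good-cell (suc (x + suc y)) x (suc y) eq′) (trans (cong backward match) back)
      ... | inj₁ p≡R rewrite p≡R = subst₂ _<_ (sym (rank-flip n x (suc y) T)) (sym (rank-flip n x y T))
        (rank-west RevN (λ {n} {y} {x} → RevN-column {n} {y} {x}) (λ {n} {y} {x} → RevN-up {n} {y} {x})
          n y x (s≤s (ℕ.≤-trans (ℕ.≤-reflexive (ℕ.+-comm y x)) (ℕ.n≤1+n _)))
          (s , trans (sym (canon-suc x y)) eq , backward-N back))
      ... | inj₂ (p≡M , ≢0 , x≡5) rewrite p≡M =
        subst₂ _<_ (sym (rank-flip n x (suc y) M)) (sym (rank-flip n x y T)) (rank-corner (suc (x + y)) y x
          (≢0 ∘ trans (row-cell (x + suc y) x (suc y) eq′)) (trans (sym (column-cell (x + suc y) x (suc y) eq′)) x≡5))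

    descends : ∀ {p t} d → canon p ≡ just t → inward d (glue t d) ≡ true → rankOf (p ⊕ d) < rankOf p
    descends {+ x , + y} d eq in! with canonState (+ x , + y) in eqs
    descends {+ x , + y} d refl in! | just s = subst (rankOf ((+ x , + y) ⊕ d) <_) (cong (rankState (+ x , + y)) eqs)
      (go d (subst (λ g → inward d g ≡ true) (glue-side d s) in!))
      where
      go : ∀ d → inward d (side d s) ≡ true → rankOf ((+ x , + y) ⊕ d) < rankOf (+ x , + y)
      go W in! with descend-W x y eqs in!
      ... | x′ , refl , lt rewrite ℕ.+-identityʳ y = lt
      go S in! with descend-S x y eqs in!
      ... | y′ , refl , lt rewrite ℕ.+-identityʳ x = lt
      go E in! rewrite ℕ.+-comm x 1 | ℕ.+-identityʳ y = descend-E x y eqs in!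
      go N in! rewrite ℕ.+-comm y 1 | ℕ.+-identityʳ x = descend-N x y eqs in!

-- Finite verification of a substitution

bit : Bool → ℕ
bit true  = 1
bit false = 0

code : List ℕ → ℕ
code = foldr (λ d r → d + r * 8) 0

at : ℕ → ℕ → ℕ → ℕ → Bool
at a b x y = (a ≡ᵇ x) ∧ (b ≡ᵇ y)

data Table : Set where
  leaf : Table
  node : ℕ → List ℕ → Table → Table → Table

lookup : ℕ → Table → Maybe (List ℕ)
lookup k leaf = nothing
lookup k (node l v t u) = if k ≡ᵇ l then just v else if k <ᵇ l then lookup k t else lookup k u

-- An existing entry is kept. Tables are untrusted: a conflict shows when `agree` reads the entry
-- back.
insert : ℕ → List ℕ → Table → Table
insert k v leaf = node k v leaf leaf
insert k v (node l v′ t u) =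
  if k ≡ᵇ l then node l v′ t u
  else if k <ᵇ l then node l v′ (insert k v t) u else node l v′ t (insert k v u)

values : Table → List (List ℕ)
values leaf = []
values (node _ v t u) = v ∷ values t ++ values u

same : List ℕ → List ℕ → Bool
same [] [] = true
same (x ∷ xs) (y ∷ ys) = (x ≡ᵇ y) ∧ same xs ys
same _ _ = false

agree : Table → ℕ → List ℕ → Bool
agree τ k v = maybe (same v) false (lookup k τ)

_⇒_ : Bool → Bool → Bool
a ⇒ b = if a then b else true

isM isT isR : Part → Bool
isM M = true
isM _ = false
isT T = true
isT _ = false
isR R = true
isR _ = false

six : List ℕ
six = upTo 6

-- Glues are smaller than 8 ^ 13 = 549755813888.
inputKey : Tile → ℕ
inputKey t = foldr (λ d k → inputGlue t d + k * 549755813888) 0 dirs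

glues : Tile → List ℕ
glues t = map (glue t) dirs

∧-split : ∀ {a b} → a ∧ b ≡ true → a ≡ true × b ≡ true
∧-split {true} eq = refl , eq

∨-split : ∀ {a b} → a ∨ b ≡ true → a ≡ true ⊎ b ≡ true
∨-split {true}  _  = inj₁ refl
∨-split {false} eq = inj₂ eq

⇒-elim : ∀ {a b} → (a ⇒ b) ≡ true → a ≡ true → b ≡ true
⇒-elim eq refl = eq

all-∈ : ∀ {A : Set} (p : A → Bool) {xs x} → all p xs ≡ true → x ∈ xs → p x ≡ true
all-∈ p {x ∷ xs} eq (here refl) = proj₁ (∧-split {p x} eq)
all-∈ p {x ∷ xs} eq (there x∈)  = all-∈ p (proj₂ (∧-split {p x} eq)) x∈

is-≢0 : ∀ n → is n ≡ true → n ≢ 0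
is-≢0 (suc _) _ ()

<⇒<ᵇ : ∀ {m n} → m < n → (m <ᵇ n) ≡ true
<⇒<ᵇ {m} {n} m<n with m <ᵇ n in eq
... | true  = refl
... | false = ⊥-elim (subst Bool.T eq (ℕ.<⇒<ᵇ m<n))

same-sound : ∀ xs ys → same xs ys ≡ true → xs ≡ ys
same-sound [] [] _ = refl
same-sound (x ∷ xs) (y ∷ ys) eq with ∧-split {x ≡ᵇ y} eq
... | p , q = cong₂ _∷_ (≡ᵇ⇒≡ x y p) (same-sound xs ys q)

same-refl : ∀ xs → same xs xs ≡ true
same-refl [] = refl
same-refl (x ∷ xs) = trans (cong (_∧ same xs xs) (≡ᵇ-refl x)) (same-refl xs)
  where
  ≡ᵇ-refl : ∀ n → (n ≡ᵇ n) ≡ true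
  ≡ᵇ-refl zero    = refl
  ≡ᵇ-refl (suc n) = ≡ᵇ-refl n

isM-sound : ∀ p → isM p ≡ true → p ≡ M
isM-sound M _ = refl

isT-sound : ∀ p → isT p ≡ true → p ≡ T
isT-sound T _ = refl

isR-sound : ∀ p → isR p ≡ true → p ≡ R
isR-sound R _ = refl

lookup-∈ : ∀ k τ {v} → lookup k τ ≡ just v → v ∈ values τ
lookup-∈ k (node l v t u) eq with k ≡ᵇ l
lookup-∈ k (node l v t u) refl | true = here refl
... | false with k <ᵇ l
...   | true  = there (∈-++⁺ˡ (lookup-∈ k t eq))
...   | false = there (∈-++⁺ʳ (values t) (lookup-∈ k u eq))

agree-lookup : ∀ τ k v → agree τ k v ≡ true → lookup k τ ≡ just v
agree-lookup τ k v eq with lookup k τ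
... | just v′ = cong just (sym (same-sound v v′ eq))

-- This certifies functional dependence: reading the table once per object replaces the comparison
-- of all pairs.
agree-unique : ∀ τ {k} v v′ → agree τ k v ≡ true → agree τ k v′ ≡ true → v ≡ v′
agree-unique τ {k} v v′ p q = just-injective (trans (sym (agree-lookup τ k v p)) (agree-lookup τ k v′ q))

map-≡ : ∀ {A : Set} {f g : A → ℕ} {xs x} → map f xs ≡ map g xs → x ∈ xs → f x ≡ g x
map-≡ eq (here refl) = proj₁ (∷-injective eq)
map-≡ eq (there x∈)  = map-≡ (proj₂ (∷-injective eq)) x∈

module Certificate
  (State : Set) (root : State) (child : State → ℕ → ℕ → State) (side : Dir → State → ℕ)
  (column row : State → ℕ)
  (column-child : ∀ s a b → column (child s a b) ≡ a) (row-child : ∀ s a b → row (child s a b) ≡ b)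
  (fields : State → List ℕ) (fromFields : List ℕ → State) (from-fields : ∀ s → fromFields (fields s) ≡ s)
  (revE : State → Bool) (backward-E : ∀ {s} → backward (side E s) ≡ true → revE s ≡ true)
  (child-root : child root 0 0 ≡ root) (root-W : side W root ≡ 0) (root-S : side S root ≡ 0)
  (inputs-root : inputStrength (Substitution.toTile State root child side column row root) ≡ 0)
  where

  open Substitution State root child side column row

  digits : List (ℕ × ℕ)
  digits = foldr (λ a l → foldr (λ b l → if hole a b then l else (a , b) ∷ l) l six) [] six

  -- Depth-first search; a state is recorded before its children, so cycles such as the one at
  -- `root` end.
  visit : (State → Table → Table) → State → Table → Table
  visit f s τ =
    if is-nothing (lookup (code (fields s)) τ)
    then foldr (λ p → f (child s (proj₁ p) (proj₂ p))) (insert (code (fields s)) (fields s) τ) digits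
    else τ

  explore : ℕ → State → Table → Table
  explore zero    s τ = τ
  explore (suc n) s τ = visit (explore n) s τ

  states : Table → List State
  states = map fromFields ∘ values

  -- The glues on one side of a block, one level down.  They have to be a function of the glue of
  -- the block itself, so that blocks that match have children that match.
  seam : Dir → Maybe State → List ℕ
  seam E m = map (λ b → sideOf E (expand m 5 b)) six
  seam W m = map (λ b → sideOf W (expand m 0 b)) six
  seam N m = map (λ a → sideOf N (expand m a 5)) six
  seam S m = map (λ a → sideOf S (expand m a 0)) six

  -- Opposite sides share one table, since equal glues must expand equally on both; `nothing`
  -- contributes the glue 0 of holes and of the outside.
  seams : Dir → Table → Table
  seams d τ = foldr (put ∘ just) (put nothing leaf) (states τ)
    where
    put : Maybe State → Table → Table
    put m U = insert (sideOf d m) (seam d m) (insert (sideOf (opp d) m) (seam (opp d) m) U)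

  keys : Table → Table
  keys τ = foldr (put ∘ toTile) leaf (states τ)
    where
    put : Tile → Table → Table
    put t = insert (inputKey t) (glues t)

  checkAt : Table → State → ℕ → ℕ → Bool
  checkAt τ s a b =
    ((a <ᵇ 5) ⇒ (sideOf E (expand (just s) a b) ≡ᵇ sideOf W (expand (just s) (suc a) b)))
    ∧ ((b <ᵇ 5) ⇒ (sideOf N (expand (just s) a b) ≡ᵇ sideOf S (expand (just s) a (suc b))))
    ∧ (not (hole a b) ⇒ agree τ (code (fields (child s a b))) (fields (child s a b)))

  isRoot : State → Bool
  isRoot s = same (fields s) (fields root)

  checkFlow : State → Bool
  checkFlow s =
    (revE s ⇒ (row s ≡ᵇ 5))
    ∧ (backward (side N s) ⇒ (column s ≡ᵇ 5))
    ∧ (revE (child s 5 5) ⇒ revE s)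
    ∧ (backward (side N (child s 5 5)) ⇒ backward (side N s))
    ∧ (backward (side W s) ⇒ (isT (part s) ∨ (isM (part s) ∧ is (column s) ∧ (row s ≡ᵇ 5))))
    ∧ (backward (side S s) ⇒ (isR (part s) ∨ (isM (part s) ∧ is (row s) ∧ (column s ≡ᵇ 5))))
    ∧ (backward (side N s) ⇒ isR (part s))
    ∧ (isRoot (child s 0 0) ⇒ isRoot s)

  checkSeams : Table → Table → Maybe State → Bool
  checkSeams SE SN m =
    agree SE (sideOf E m) (seam E m) ∧ agree SE (sideOf W m) (seam W m)
    ∧ agree SN (sideOf N m) (seam N m) ∧ agree SN (sideOf S m) (seam S m)

  checkTile : Table → Tile → Bool
  checkTile KS t = agree KS (inputKey t) (glues t)

  checkState : Table → Table → Table → Table → State → Bool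
  checkState τ SE SN KS s =
    checkSeams SE SN (just s) ∧ checkTile KS (toTile s) ∧ ((inputStrength (toTile s) ≡ᵇ 2) ∨ isRoot s)
    ∧ checkFlow s ∧ all (λ a → all (checkAt τ s a) six) six

  checkAll : Table → Table → Table → Table → Bool
  checkAll τ SE SN KS =
    agree τ (code (fields root)) (fields root) ∧ checkSeams SE SN nothing
    ∧ all (checkState τ SE SN KS) (states τ)

  check : Table → Bool
  check τ = checkAll τ (seams E τ) (seams N τ) (keys τ)

  module Checked (τ : Table) (checked : check τ ≡ true) where

    SE SN KS : Table
    SE = seams E τ
    SN = seams N τ
    KS = keys τ

    fields-injective : ∀ {s t} → fields s ≡ fields t → s ≡ t
    fields-injective {s} {t} eq = trans (sym (from-fields s)) (trans (cong fromFields eq) (from-fields t))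

    Good : State → Set
    Good s = s ∈ states τ

    agree-good : ∀ {s} → agree τ (code (fields s)) (fields s) ≡ true → Good s
    agree-good {s} eq = subst (_∈ states τ) (from-fields s)
      (∈-map⁺ fromFields (lookup-∈ (code (fields s)) τ (agree-lookup τ (code (fields s)) (fields s) eq)))

    good-root : Good root
    good-root = agree-good (proj₁ (∧-split {agree τ (code (fields root)) (fields root)} checked))

    state-checked : ∀ {s} → Good s → checkState τ SE SN KS s ≡ true
    state-checked = all-∈ (checkState τ SE SN KS) (proj₂ (∧-split {checkSeams SE SN nothing}
      (proj₂ (∧-split {agree τ (code (fields root)) (fields root)} checked))))

    seams-checked : ∀ m → (∀ {s} → m ≡ just s → Good s) → checkSeams SE SN m ≡ true
    seams-checked nothing  _ = proj₁ (∧-split {checkSeams SE SN nothing}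
      (proj₂ (∧-split {agree τ (code (fields root)) (fields root)} checked)))
    seams-checked (just s) g = proj₁ (∧-split {checkSeams SE SN (just s)} (state-checked (g refl)))

    module _ {s} (g : Good s) where

      private
        strongᵇ : Bool
        strongᵇ = (inputStrength (toTile s) ≡ᵇ 2) ∨ isRoot s
        q₁ q₂ q₃ q₄ q₅ q₆ q₇ : Bool
        q₁ = revE s ⇒ (row s ≡ᵇ 5)
        q₂ = backward (side N s) ⇒ (column s ≡ᵇ 5)
        q₃ = revE (child s 5 5) ⇒ revE s
        q₄ = backward (side N (child s 5 5)) ⇒ backward (side N s)
        q₅ = backward (side W s) ⇒ (isT (part s) ∨ (isM (part s) ∧ is (column s) ∧ (row s ≡ᵇ 5)))
        q₆ = backward (side S s) ⇒ (isR (part s) ∨ (isM (part s) ∧ is (row s) ∧ (column s ≡ᵇ 5)))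
        q₇ = backward (side N s) ⇒ isR (part s)
        r₁ = proj₂ (∧-split {checkSeams SE SN (just s)} (state-checked g))
        r₂ = proj₂ (∧-split {checkTile KS (toTile s)} r₁)
        r₃ = proj₂ (∧-split {strongᵇ} r₂)
        p₁ = proj₁ (∧-split {checkFlow s} r₃)
        p₂ = proj₂ (∧-split {q₁} p₁)
        p₃ = proj₂ (∧-split {q₂} p₂)
        p₄ = proj₂ (∧-split {q₃} p₃)
        p₅ = proj₂ (∧-split {q₄} p₄)
        p₆ = proj₂ (∧-split {q₅} p₅)
        p₇ = proj₂ (∧-split {q₆} p₆)
        p₈ = proj₂ (∧-split {q₇} p₇)

      tile-checked : checkTile KS (toTile s) ≡ true
      tile-checked = proj₁ (∧-split {checkTile KS (toTile s)} r₁)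

      isRoot-sound : ∀ {s} → isRoot s ≡ true → s ≡ root
      isRoot-sound {s} eq = fields-injective (same-sound (fields s) (fields root) eq)

      inputs-state : inputStrength (toTile s) ≡ 2 ⊎ s ≡ root
      inputs-state with ∨-split {inputStrength (toTile s) ≡ᵇ 2} (proj₁ (∧-split {strongᵇ} r₂))
      ... | inj₁ two = inj₁ (≡ᵇ⇒≡ _ 2 two)
      ... | inj₂ eq  = inj₂ (isRoot-sound eq)

      revE-row : revE s ≡ true → row s ≡ 5
      revE-row rev = ≡ᵇ⇒≡ (row s) 5 (⇒-elim (proj₁ (∧-split {q₁} p₁)) rev)

      revN-column : backward (side N s) ≡ true → column s ≡ 5
      revN-column rev = ≡ᵇ⇒≡ (column s) 5 (⇒-elim (proj₁ (∧-split {q₂} p₂)) rev)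

      revE-child : revE (child s 5 5) ≡ true → revE s ≡ true
      revE-child = ⇒-elim (proj₁ (∧-split {q₃} p₃))

      revN-child : backward (side N (child s 5 5)) ≡ true → backward (side N s) ≡ true
      revN-child = ⇒-elim (proj₁ (∧-split {q₄} p₄))

      backward-W : backward (side W s) ≡ true → part s ≡ T ⊎ (part s ≡ M × column s ≢ 0 × row s ≡ 5)
      backward-W back with ∨-split {isT (part s)} (⇒-elim (proj₁ (∧-split {q₅} p₅)) back)
      ... | inj₁ t = inj₁ (isT-sound _ t)
      ... | inj₂ m with ∧-split {isM (part s)} m
      ...   | m! , r with ∧-split {is (column s)} r
      ...     | ≢0 , ≡5 = inj₂ (isM-sound _ m! , is-≢0 _ ≢0 , ≡ᵇ⇒≡ _ 5 ≡5)

      backward-S : backward (side S s) ≡ true → part s ≡ R ⊎ (part s ≡ M × row s ≢ 0 × column s ≡ 5)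
      backward-S back with ∨-split {isR (part s)} (⇒-elim (proj₁ (∧-split {q₆} p₆)) back)
      ... | inj₁ t = inj₁ (isR-sound _ t)
      ... | inj₂ m with ∧-split {isM (part s)} m
      ...   | m! , r with ∧-split {is (row s)} r
      ...     | ≢0 , ≡5 = inj₂ (isM-sound _ m! , is-≢0 _ ≢0 , ≡ᵇ⇒≡ _ 5 ≡5)

      backward-N-R : backward (side N s) ≡ true → part s ≡ R
      backward-N-R back = isR-sound _ (⇒-elim (proj₁ (∧-split {q₇} p₇)) back)

      root-child : child s 0 0 ≡ root → s ≡ root
      root-child eq = isRoot-sound (⇒-elim p₈ (trans (cong isRoot eq) (same-refl (fields root))))

      module _ {a b} (a<6 : a < 6) (b<6 : b < 6) where

        private
          eastᵇ northᵇ : Bool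
          eastᵇ  = (a <ᵇ 5) ⇒ (sideOf E (expand (just s) a b) ≡ᵇ sideOf W (expand (just s) (suc a) b))
          northᵇ = (b <ᵇ 5) ⇒ (sideOf N (expand (just s) a b) ≡ᵇ sideOf S (expand (just s) a (suc b)))
          at-checked : checkAt τ s a b ≡ true
          at-checked = all-∈ (checkAt τ s a) (all-∈ (λ a → all (checkAt τ s a) six)
            (proj₂ (∧-split {checkFlow s} r₃)) (∈-upTo⁺ a<6)) (∈-upTo⁺ b<6)

        inner-E : a < 5 → sideOf E (expand (just s) a b) ≡ sideOf W (expand (just s) (suc a) b)
        inner-E a<5 = ≡ᵇ⇒≡ _ _ (⇒-elim (proj₁ (∧-split {eastᵇ} at-checked)) (<⇒<ᵇ a<5))

        inner-N : b < 5 → sideOf N (expand (just s) a b) ≡ sideOf S (expand (just s) a (suc b))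
        inner-N b<5 = ≡ᵇ⇒≡ _ _ (⇒-elim (proj₁ (∧-split {northᵇ} (proj₂ (∧-split {eastᵇ} at-checked)))) (<⇒<ᵇ b<5))

        good-child : hole a b ≡ false → Good (child s a b)
        good-child solid = agree-good (⇒-elim
          (proj₂ (∧-split {northᵇ} (proj₂ (∧-split {eastᵇ} at-checked)))) (cong not solid))

    module _ {m m′ b} (g : ∀ {s} → m ≡ just s → Good s) (g′ : ∀ {s} → m′ ≡ just s → Good s) (b<6 : b < 6) where

      private
        seamE seamW seamN seamS : Maybe State → Bool
        seamE m = agree SE (sideOf E m) (seam E m)
        seamW m = agree SE (sideOf W m) (seam W m)
        seamN m = agree SN (sideOf N m) (seam N m)
        seamS m = agree SN (sideOf S m) (seam S m)

      seam-E : sideOf E m ≡ sideOf W m′ → sideOf E (expand m 5 b) ≡ sideOf W (expand m′ 0 b)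
      seam-E eq = map-≡ {f = λ b → sideOf E (expand m 5 b)} {g = λ b → sideOf W (expand m′ 0 b)} {xs = six} (agree-unique SE (seam E m) (seam W m′)
        (subst (λ k → agree SE k (seam E m) ≡ true) eq (proj₁ (∧-split {seamE m} (seams-checked m g))))
        (proj₁ (∧-split {seamW m′} (proj₂ (∧-split {seamE m′} (seams-checked m′ g′)))))) (∈-upTo⁺ b<6)

      seam-N : sideOf N m ≡ sideOf S m′ → sideOf N (expand m b 5) ≡ sideOf S (expand m′ b 0)
      seam-N eq = map-≡ {f = λ a → sideOf N (expand m a 5)} {g = λ a → sideOf S (expand m′ a 0)} {xs = six} (agree-unique SN (seam N m) (seam S m′)
        (subst (λ k → agree SN k (seam N m) ≡ true) eq
          (proj₁ (∧-split {seamN m} (proj₂ (∧-split {seamW m} (proj₂ (∧-split {seamE m} (seams-checked m g))))))))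
        (proj₂ (∧-split {seamN m′} (proj₂ (∧-split {seamW m′} (proj₂ (∧-split {seamE m′} (seams-checked m′ g′)))))))) (∈-upTo⁺ b<6)

    open Grow Good good-root (λ g a<6 b<6 → good-child g a<6 b<6) child-root root-W root-S
      (λ g a<5 b<6 → inner-E g (ℕ.m<n⇒m<1+n a<5) b<6 a<5)
      (λ g a<6 b<5 → inner-N g a<6 (ℕ.m<n⇒m<1+n b<5) b<5)
      seam-E seam-N revE (backward ∘ side N) backward-E (λ eq → eq) column-child row-child
      revE-row revN-column revE-child revN-child backward-W backward-S backward-N-R inputs-state root-child inputs-root

    tiles : List Tile
    tiles = map toTile (states τ)

    member : ∀ {p t} → canon p ≡ just t → t ∈ tiles
    member {+ x , + y} eq with cell (suc (x + y)) x y in eqs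
    member {+ x , + y} refl | just s = ∈-map⁺ toTile (good-cell (suc (x + y)) x y eqs)

    inputs : ∀ {t} → t ∈ tiles → inputStrength t ≡ 2 ⊎ t ≡ toTile root
    inputs t∈ with ∈-map⁻ toTile t∈
    ... | s , g , refl with inputs-state g
    ...   | inj₁ two  = inj₁ two
    ...   | inj₂ refl = inj₂ refl

    glues-injective : ∀ {t t′} → glues t ≡ glues t′ → t ≡ t′
    glues-injective {t} {t′} eq = cong (λ { (n ∷ e ∷ s ∷ w ∷ []) → tile n e s w ; _ → t }) eq

    determined : ∀ {t t′} → t ∈ tiles → t′ ∈ tiles → (∀ d → inputGlue t d ≡ inputGlue t′ d) → t ≡ t′
    determined {t} {t′} t∈ t′∈ eq = glues-injective (agree-unique KS (glues t) (glues t′) (checked-∈ t∈)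
      (subst (λ k → agree KS k (glues t′) ≡ true) (sym same-key) (checked-∈ t′∈)))
      where
      checked-∈ : ∀ {t} → t ∈ tiles → checkTile KS t ≡ true
      checked-∈ t∈ with ∈-map⁻ toTile t∈
      ... | s , g , refl = tile-checked g
      same-key : inputKey t ≡ inputKey t′
      same-key = go dirs
        where
        go : ∀ ds → foldr (λ d k → inputGlue t d + k * 549755813888) 0 ds ≡ foldr (λ d k → inputGlue t′ d + k * 549755813888) 0 ds
        go []       = refl
        go (d ∷ ds) = cong₂ (λ g k → g + k * 549755813888) (eq d) (go ds)

    open Deterministic canon tiles origin (toTile root) start (λ {p} → member {p}) inputs inputs-root (λ {p} → seed-once {p}) determined
      adjacent rankOf (λ {p} → descends {p}) using (system; self-assembles)

    assembles : Σ TAS λ 𝒮 → (TAS.temp 𝒮 ≡ 2) × StrictlySelfAssembles 𝒮 (FractalShape K)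
    assembles = system , refl , self-assembles canon-shape

-- The tile system

-- A block of any level; a tile is a block of level 0.  The vertical line between the children
-- (a , b) and (a + 1 , b) of a block has the label (a , b), and so has the horizontal line between
-- its children (a , b) and (a , b + 1).  Flags are 0 or 1.
record State : Set where
  constructor state
  field
    i j     : ℕ       -- position in the parent block
    w       : ℕ       -- 1 + m east of a hole in a block of mark m, or of the border of the quadrant; else 0
    s       : ℕ       -- north of a hole, or of the border of the quadrant?
    e₁ e₂   : ℕ       -- label of the line on the east side
    e?      : ℕ       -- does that label arrive from the north?
    n₁ n₂   : ℕ       -- label of the line on the north side
    n?      : ℕ       -- does that label arrive from the east?
    nd      : ℕ       -- 1 + m if the line on the north side borders a hole in a block of mark m
    pe pn   : ℕ       -- e? of the parent, known in column 4, and n? of the parent, known in row 4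
    d       : ℕ       -- mark of the largest block on whose diagonal this one lies, 0 if never needed
    vw      : ℕ       -- does d arrive from the west rather than from the south?
    sr      : ℕ       -- n? of the southern neighbour
    nw      : ℕ       -- for the northern neighbour: 1 + its d, or 4 + m if its w is to be 1 + m
    se      : ℕ       -- for the eastern neighbour: 1 + its d, or 4 if its s is to be 1
    dd      : ℕ       -- 1 + d of the block (5 , 5), on its detour through (4 , 5)

-- 1 for the last column, 2 for the last row; the blocks with a ≡ b lie on the diagonal of their
-- parent and carry its mark instead.
mark : ℕ → ℕ → ℕ
mark a b = if a ≡ᵇ b then 0 else if a ≡ᵇ 5 then 1 else if b ≡ᵇ 5 then 2 else 0

-- Only the last column and row inherit the outer lines; other children border on inner lines,
-- labelled by their own position. The label of an inner vertical line arrives from the north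
-- exactly if there is no southern neighbour (`s′`), and symmetrically for `w′`.
child : State → ℕ → ℕ → State
child t a b = state a b w′ s′
    (if a <ᵇ 5 then a else e₁) (if a <ᵇ 5 then b else e₂) (if a <ᵇ 5 then s′ else e?)
    (if b <ᵇ 5 then a else n₁) (if b <ᵇ 5 then b else n₂)
    (if b <ᵇ 5 then bit (is w′) else n?)
    (if b <ᵇ 5 then (if (b ≡ᵇ 1) ∧ mid a then suc d else 0) else nd)
    (if a ≡ᵇ 4 then e? else 0) (if b ≡ᵇ 4 then n? else 0)
    (if is w′ ∨ is s′ then 0 else if a ≡ᵇ b then d else mark a b)
    (if at a b 0 0 then vw else if b ≡ᵇ 0 then sr else 0)
    (if b ≡ᵇ 0 then sr else bit (((a ≡ᵇ 0) ∧ is w) ∨ at a b 4 3 ∨ at a b 4 4))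
    (if is w′ ∨ ((b ≡ᵇ 1) ∧ mid a) then 0
     else if b <ᵇ 5 then (if at a b 4 1 then 4 + d else suc (if a ≡ᵇ suc b then d else mark a (suc b)))
     else if a ≡ᵇ 0 then nw else if is n? then 0 else suc (mark a 0))
    (if is s′ then 0 else if is b then (if at a b 1 4 then 4 else 0)
     else if a <ᵇ 5 then (if is sr then suc (mark (suc a) 0) else 0) else se)
    (if at a b 4 5 ∧ is e? then suc d else 0)
  where
  open State t
  w′ = if a ≡ᵇ 0 then w else if (a ≡ᵇ 4) ∧ mid b then suc d else 0
  s′ = if b ≡ᵇ 0 then s else bit ((b ≡ᵇ 4) ∧ mid a)

-- A fixed point of `child` at (0 , 0): the corner block of every level, on both borders of the
-- quadrant.
root : State
root = state 0 0 1 1 0 0 1 0 0 1 0 0 0 0 0 0 0 0 0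

-- Which line has the lower level, and hence ends, where the lines on the north side and on the
-- east side of a block cross.
data Order : Set where
  level hEnds vEnds : Order

order : State → Order
order t =
  if is n? then (if not (is e?) ∧ (e₂ ≡ᵇ 5) then vEnds else level)
  else if is e? then (if n₁ ≡ᵇ 5 then hEnds else level)
  else if n₁ ≡ᵇ 5 then (if (e₂ ≡ᵇ 5) ∧ (d ≡ᵇ 2) then vEnds else hEnds)
  else if e₂ ≡ᵇ 5 then vEnds else level
  where open State t

-- The fields nd and nw passed on to the east where two lines labelled (a , b) cross.
levelMark : ℕ → ℕ → ℕ → ℕ → ℕ
levelMark a b d nd = if at a b 1 1 then suc d else if at a b 2 1 then nd else 0

levelCorner : ℕ → ℕ → ℕ → ℕ → ℕ
levelCorner a b d nd =
  if (b ≡ᵇ 1) ∧ mid (suc a) then 0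
  else if at a b 3 1 then 3 + nd
  else suc (if a ≡ᵇ b then d else mark (suc a) (suc b))

-- The lowest octal digit of a glue is its strength, plus 4 if information crosses the edge backward.
-- What follows describes the receiving tile: its position and the labels it cannot compute itself.
gE : State → ℕ
gE t =
  if (e₁ ≡ᵇ 1) ∧ mid e₂ then 0
  else if back then code (5 ∷ x ∷ j ∷ n₁ ∷ n₂ ∷ nd ∷ [])
  else code ((if (S′ ∧ (x <ᵇ 5)) ∨ (at x j 5 5 ∧ is pe ∧ (n₁ <ᵇ 5)) then 2 else 1)
             ∷ x ∷ j ∷ label ++ S″ ∷ (if is dd then dd else if se <ᵇ 4 then se else 0)
             ∷ bit ((j ≡ᵇ 4) ∧ is pn ∧ ((i <ᵇ 5) ∨ (e₂ ≡ᵇ 5))) ∷ [])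
  where
  open State t
  x = if i ≡ᵇ 5 then 0 else suc i
  -- The flag `s` of the eastern neighbour; a hole ends at the line labelled (3 , 4).
  S′ = if is s then not (at e₁ e₂ 3 4) else (se ≡ᵇ 4)
  S″ = bit S′
  back : Bool
  back with order t
  ... | vEnds = (j ≡ᵇ 5) ∧ is n? ∧ ((i ≡ᵇ 5) ∨ not (is pe))
  ... | _     = (j ≡ᵇ 5) ∧ is n? ∧ (i <ᵇ 5) ∧ not (is pe)
  crossed : Order → List ℕ
  crossed level = suc n₁ ∷ n₂ ∷ levelMark n₁ n₂ d nd ∷ levelCorner n₁ n₂ d nd ∷ []
  crossed hEnds = 0 ∷ n₂ ∷ 0 ∷ suc (mark 0 (suc n₂)) ∷ []
  crossed vEnds = n₁ ∷ n₂ ∷ nd ∷ (if is n? then 0 else suc (mark (suc e₁) 0)) ∷ []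
  label : List ℕ
  label =
    if j ≡ᵇ 5 then (if i ≡ᵇ 5 then crossed (order t)
                    else n₁ ∷ n₂ ∷ nd ∷ (if is n? then 0 else suc (mark x 0)) ∷ [])
    else if i ≡ᵇ 5 then 0 ∷ 0 ∷ 0 ∷ suc (mark 0 (suc j)) ∷ []
    else 0 ∷ 0 ∷ levelMark i j d nd ∷ levelCorner i j d nd ∷ []

-- The edge seen from its eastern block. Strength 2 marks a sole input: there is no southern
-- neighbour and, outside column 5, no label from the north; or the corner (5 , 5) sends its
-- vertical label south and gets nothing from the north.
gW : State → ℕ
gW t =
  if is w then 0
  else if (j ≡ᵇ 5) ∧ is n? ∧ not both then code (5 ∷ i ∷ j ∷ n₁ ∷ n₂ ∷ nd ∷ [])
  else code ((if (is s ∧ (i <ᵇ 5)) ∨ (at i j 5 5 ∧ is e? ∧ (n₁ <ᵇ 5)) then 2 else 1)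
             ∷ i ∷ j ∷ (if j ≡ᵇ 5 then n₁ else 0) ∷ (if j ≡ᵇ 5 then n₂ else 0) ∷ nd ∷ nw ∷ s
             ∷ (if (is vw ∧ not (is s)) ∨ (at i j 5 5 ∧ is e?) then suc d else 0) ∷ pn ∷ [])
  where
  open State t
  both = (i ≡ᵇ 5) ∧ is n? ∧ is e?

gN : State → ℕ
gN t =
  if (n₂ ≡ᵇ 1) ∧ mid n₁ then 0
  else if (i ≡ᵇ 5) ∧ is e? ∧ back then code (5 ∷ i ∷ y ∷ e₁ ∷ e₂ ∷ (if y ≡ᵇ 5 then u else 0) ∷ [])
  else code ((if ((3 <ᵇ u) ∧ (y <ᵇ 5)) ∨ (at i y 5 5 ∧ is pn ∧ (e₂ <ᵇ 5)) ∨ (at i y 4 5 ∧ is pn ∧ is pe) then 2 else 1)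
             ∷ i ∷ y ∷ label ++ n?
             ∷ bit ((i ≡ᵇ 4) ∧ is pe ∧ ((j <ᵇ 5) ∨ (n₁ ≡ᵇ 5)))
             ∷ (if at i j 4 4 ∧ is pe then suc d else 0) ∷ [])
  where
  open State t
  y = if j ≡ᵇ 5 then 0 else suc j
  u = if is w then (if at n₁ n₂ 4 3 then w else 3 + w) else nw
  back : Bool
  back with order t
  ... | hEnds = (j <ᵇ 5) ∨ not (is n?)
  ... | _     = j <ᵇ 5
  crossed : Order → List ℕ
  crossed level = e₁ ∷ suc e₂ ∷ u ∷ (if at n₁ n₂ 1 3 then 4 else 0) ∷ []
  crossed hEnds = e₁ ∷ e₂ ∷ u ∷ 0 ∷ []
  crossed vEnds = e₁ ∷ 0 ∷ u ∷ (if is n? then suc (mark (suc e₁) 0) else 0) ∷ []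
  label : List ℕ
  label =
    if i ≡ᵇ 5 then (if j ≡ᵇ 5 then crossed (order t) else e₁ ∷ e₂ ∷ u ∷ 0 ∷ [])
    else 0 ∷ 0 ∷ u ∷ (if j ≡ᵇ 5 then (if is n? then suc (mark (suc i) 0) else 0)
                      else if at i j 1 3 then 4 else 0) ∷ []

gS : State → ℕ
gS t =
  if is s then 0
  else if (i ≡ᵇ 5) ∧ is e? then code (5 ∷ i ∷ j ∷ e₁ ∷ e₂ ∷ (if j ≡ᵇ 5 then u else 0) ∷ [])
  else code ((if (is w ∧ (j <ᵇ 5)) ∨ (at i j 5 5 ∧ is n? ∧ (e₂ <ᵇ 5)) ∨ (at i j 4 5 ∧ is pe ∧ is n?) then 2 else 1)
             ∷ i ∷ j ∷ (if i ≡ᵇ 5 then e₁ else 0) ∷ (if i ≡ᵇ 5 then e₂ else 0) ∷ u ∷ se ∷ sr ∷ pe ∷ dd ∷ [])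
  where
  open State t
  u = if is w then 3 + w else if is vw then 0 else suc d

fields : State → List ℕ
fields t = i ∷ j ∷ w ∷ s ∷ e₁ ∷ e₂ ∷ e? ∷ n₁ ∷ n₂ ∷ n? ∷ nd ∷ pe ∷ pn ∷ d ∷ vw ∷ sr ∷ nw ∷ se ∷ dd ∷ []
  where open State t

side : Dir → State → ℕ
side N = gN
side E = gE
side S = gS
side W = gW

-- At (4 , 5) with both flags set the eastern glue is not backward but that of the child (5 , 5) is.
-- The extra case lets the property pass from this child to its parent.
revE : State → Bool
revE t = backward (gE t) ∨ (at i j 4 5 ∧ is pe ∧ is n?)
  where open State t

fromFields : List ℕ → State
fromFields (i ∷ j ∷ w ∷ s ∷ e₁ ∷ e₂ ∷ e? ∷ n₁ ∷ n₂ ∷ n? ∷ nd ∷ pe ∷ pn ∷ d ∷ vw ∷ sr ∷ nw ∷ se ∷ dd ∷ []) =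
  state i j w s e₁ e₂ e? n₁ n₂ n? nd pe pn d vw sr nw se dd
fromFields _ = root


backward-E : ∀ {t} → backward (gE t) ≡ true → revE t ≡ true
backward-E {t} eq = cong (_∨ (at i j 4 5 ∧ is pe ∧ is n?)) eq
  where open State t

open Certificate State root child side State.i State.j (λ _ _ _ → refl) (λ _ _ _ → refl)
  fields fromFields (λ _ → refl) revE (λ {t} → backward-E {t}) refl refl refl refl

-- 1000 bounds the depth of the search; if it were too small, check would fail.
table : Table
table = explore 1000 root leaf

mainTheorem1 : Σ TAS λ 𝒮 → (TAS.temp 𝒮 ≡ 2) × StrictlySelfAssembles 𝒮 (FractalShape K)
-- `refl` makes the type checker run the search and evaluate all checks.
mainTheorem1 = Checked.assembles table refl
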